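{- Let $H$ be a fixed connected simple undirected graph with vertex set $[k]$, and let $\mathit{tw}(H)$ denote its treewidth. For $n \ge 1$, let $\mathrm{Hom}_{H,n}$ be the homomorphism polynomial of $H$ (defined in the context). Then the minimum size of a monotone arithmetic circuit computing $\mathrm{Hom}_{H,n}$ is $\Theta\bigl(n^{\mathit{tw}(H)+1}\bigr)$ as $n \to \infty$, where the constants hidden in $\Theta$ may depend on $H$.
   Context: A homomorphism from a graph $H$ to a graph $G$ is a map $\phi:V(H)\to V(G)$ such that $\{i,j\}\in E(H)$ implies $\{\phi(i),\phi(j)\}\in E(G)$; for an edge $e=\{i,j\}$ write $\phi(e)=\{\phi(i),\phi(j)\}$. The homomorphism polynomial $\mathrm{Hom}_{H,n}$ is the polynomial over $\mathbb{Q}$ in the $\binom n2$ variables $x_{\{u,v\}}$ ($u\neq v\in[n]$) given by $\mathrm{Hom}_{H,n}=\sum_{\phi}\prod_{e\in E(H)} x_{\phi(e)}$, where $\phi$ ranges over all homomorphisms from $H$ to the complete graph $K_n$ on $[n]$. An arithmetic circuit is a rooted DAG whose sources are labeled by variables or constants in $\mathbb{Q}$ and whose other nodes are $+$ or $\times$ gates; it is monotone if all constants are non-negative; its size is its number of edges. A tree decomposition of $H$ is a tree whose nodes (bags) are subsets of $V(H)$ such that every edge of $H$ is contained in some bag and, for every vertex $i$, the bags containing $i$ induce a subtree; its width is the maximum bag size minus one, and $\mathit{tw}(H)$ is the minimum width of a tree decomposition of $H$.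
   Formalization: The graph H is assumed to have at least two vertices (k ≥ 2): for a single vertex the homomorphism polynomial is the constant n, computed by one constant source with no edges, so the claimed Θ(n) bound fails there. -}

module Defs where

open import Data.Nat using (ℕ; zero; suc; _⊔_; _∸_; _≤_)
open import Data.Bool using (Bool; true; false; T; _∧_; if_then_else_)
open import Data.Fin using (Fin; zero; suc; _≟_; _<?_)
open import Data.Fin.Properties using (all?)
open import Data.Fin.Subset using (Subset; _∈_; ∣_∣)
open import Data.Vec using (Vec; []; _∷_; tabulate; zipWith; replicate; lookup; head)
import Data.Vec.Properties as VecP
import Data.Nat as Nat
open import Data.Vec.Functional as VF using ()
open import Data.List using (List; []; _∷_; _++_; map; concatMap; foldr; filter; allFin)
open import Data.Product using (Σ; _×_; _,_; proj₁; proj₂)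
open import Data.Sum using (_⊎_)
open import Data.Unit using (⊤)
open import Data.Rational as ℚ using (ℚ; 0ℚ; 1ℚ)
open import Relation.Binary.PropositionalEquality using (_≡_; _≢_)
open import Relation.Nullary using (Dec; does; ¬_)
open import Relation.Nullary.Decidable using (T?; ¬?; _→-dec_)

-- Walk R P a b : a walk from a to b along R-edges all of whose vertices
-- after a satisfy P (the start vertex a is constrained separately).
data Walk {A : Set} (R : A → A → Set) (P : A → Set) : A → A → Set where
  here : ∀ {a} → Walk R P a a
  step : ∀ {a b c} → R a b → P b → Walk R P b c → Walk R P a c

record Graph (k : ℕ) : Set where
  field
    adj    : Fin k → Fin k → Bool
    sym    : ∀ i j → adj i j ≡ adj j i
    irrefl : ∀ i → adj i i ≡ false
open Graph public

Adj : ∀ {k} → Graph k → Fin k → Fin k → Set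
Adj G i j = T (adj G i j)

Connected : ∀ {k} → Graph k → Set
Connected G = ∀ i j → Walk (Adj G) (λ _ → ⊤) i j

-- Tree decompositions.
-- A tree with node set Fin (suc m) is encoded by parent pointers: node
-- (suc i) has parent (parent i) with index ≤ i (every finite tree admits
-- such a labelling, and every such structure is a tree).

record TreeDecomposition {k : ℕ} (G : Graph k) : Set where
  field
    m         : ℕ
    parent    : Fin m → Fin (suc m)
    parent<   : ∀ i → Data.Fin.toℕ (parent i) ≤ Data.Fin.toℕ i
    bag       : Fin (suc m) → Subset k

  TAdj : Fin (suc m) → Fin (suc m) → Set
  TAdj a b = Σ (Fin m) λ i → (a ≡ suc i × b ≡ parent i) ⊎ (b ≡ suc i × a ≡ parent i)

  field
    edge-covered : ∀ i j → Adj G i j → Σ (Fin (suc m)) λ t → i ∈ bag t × j ∈ bag t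
    subtree-nonempty  : ∀ v → Σ (Fin (suc m)) λ t → v ∈ bag t
    subtree-connected : ∀ v a b → v ∈ bag a → v ∈ bag b →
                        Walk TAdj (λ t → v ∈ bag t) a b

  width : ℕ
  width = foldr _⊔_ 0 (map (λ t → ∣ bag t ∣) (allFin (suc m))) ∸ 1
open TreeDecomposition public using (width)

IsTreewidth : ∀ {k} → Graph k → ℕ → Set
IsTreewidth G t = (Σ (TreeDecomposition G) λ D → width D ≡ t)
                × (∀ (D : TreeDecomposition G) → t ≤ width D)

-- Polynomials over ℚ in the variables x_{u,v} (u ≠ v ∈ [n]).
-- A monomial is an exponent table Mono n; the exponent of x_{u,v} is
-- stored symmetrically at positions (u,v) and (v,u) (diagonal unused).

Mono : ℕ → Set
Mono n = Vec (Vec ℕ n) n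

_≟M_ : ∀ {n} (a b : Mono n) → Dec (a ≡ b)
_≟M_ = VecP.≡-dec (VecP.≡-dec Nat._≟_)

oneM : ∀ {n} → Mono n
oneM = replicate _ (replicate _ 0)

_*M_ : ∀ {n} → Mono n → Mono n → Mono n
a *M b = zipWith (zipWith Nat._+_) a b

varM : ∀ {n} → Fin n → Fin n → Mono n
varM u v = tabulate λ a → tabulate λ b →
  if does (a ≟ u) ∧ does (b ≟ v) then 1
  else if does (a ≟ v) ∧ does (b ≟ u) then 1 else 0

Poly : ℕ → Set
Poly n = List (ℚ × Mono n)

_+P_ : ∀ {n} → Poly n → Poly n → Poly n
_+P_ = _++_

_*P_ : ∀ {n} → Poly n → Poly n → Poly n
p *P q = concatMap (λ s → map (λ r → (proj₁ s ℚ.* proj₁ r , proj₂ s *M proj₂ r)) q) p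

oneP : ∀ {n} → Poly n
oneP = (1ℚ , oneM) ∷ []

coeff : ∀ {n} → Poly n → Mono n → ℚ
coeff p μ = foldr (λ s acc → if does (proj₂ s ≟M μ) then proj₁ s ℚ.+ acc else acc) 0ℚ p

_≈P_ : ∀ {n} → Poly n → Poly n → Set
p ≈P q = ∀ μ → coeff p μ ≡ coeff q μ

allMaps : (k n : ℕ) → List (Fin k → Fin n)
allMaps zero    n = (λ ()) ∷ []
allMaps (suc k) n = concatMap (λ a → map (λ f → a VF.∷ f) (allMaps k n)) (allFin n)

IsHom : ∀ {k n} → Graph k → (Fin k → Fin n) → Set
IsHom H φ = ∀ i j → Adj H i j → φ i ≢ φ j

isHom? : ∀ {k n} (H : Graph k) (φ : Fin k → Fin n) → Dec (IsHom H φ)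
isHom? H φ = all? λ i → all? λ j → T? (adj H i j) →-dec ¬? (φ i ≟ φ j)

-- ∏_{e ∈ E(H)} x_{φ(e)} ; each edge {i,j} is taken once (with i < j)
homMono : ∀ {k n} → Graph k → (Fin k → Fin n) → Mono n
homMono {k} H φ =
  foldr _*M_ oneM
    (concatMap (λ i → concatMap (λ j →
        if adj H i j ∧ does (i <? j) then varM (φ i) (φ j) ∷ [] else [])
      (allFin k)) (allFin k))

HomPoly : ∀ {k} → Graph k → (n : ℕ) → Poly n
HomPoly {k} H n = map (λ φ → (1ℚ , homMono H φ)) (filter (isHom? H) (allMaps k n))

-- Arithmetic circuits as straight-line programs (a topologically sorted
-- DAG). A gate in a circuit with g earlier gates refers to earlier gates
-- via Fin g (index zero = most recently added gate). The output (root)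
-- is the last gate. Fan-in lists may repeat a child (parallel edges).

data Gate (n g : ℕ) : Set where
  var   : (u v : Fin n) → u ≢ v → Gate n g
  const : ℚ → Gate n g
  plus  : List (Fin g) → Gate n g
  times : List (Fin g) → Gate n g

data Circuit (n : ℕ) : ℕ → Set where
  []  : Circuit n 0
  _∷_ : ∀ {g} → Gate n g → Circuit n g → Circuit n (suc g)

gateVal : ∀ {n g} → Gate n g → Vec (Poly n) g → Poly n
gateVal (var u v _) vs = (1ℚ , varM u v) ∷ []
gateVal (const q)   vs = (q , oneM) ∷ []
gateVal (plus is)   vs = foldr _+P_ [] (map (lookup vs) is)
gateVal (times is)  vs = foldr _*P_ oneP (map (lookup vs) is)

evalAll : ∀ {n g} → Circuit n g → Vec (Poly n) g
evalAll []        = []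
evalAll (gt ∷ C)  = let vs = evalAll C in gateVal gt vs ∷ vs

output : ∀ {n g} → Circuit n (suc g) → Poly n
output C = head (evalAll C)

Computes : ∀ {n g} → Circuit n (suc g) → Poly n → Set
Computes C p = output C ≈P p

-- size = number of edges = total fan-in
fanIn : ∀ {n g} → Gate n g → ℕ
fanIn (plus is)  = Data.List.length is
fanIn (times is) = Data.List.length is
fanIn _          = 0

size : ∀ {n g} → Circuit n g → ℕ
size []       = 0
size (gt ∷ C) = fanIn gt Nat.+ size C

MonotoneGate : ∀ {n g} → Gate n g → Set
MonotoneGate (const q) = 0ℚ ℚ.≤ q
MonotoneGate _         = ⊤

data Monotone {n : ℕ} : ∀ {g} → Circuit n g → Set where
  []  : Monotone []
  _∷_ : ∀ {g} {gt : Gate n g} {C : Circuit n g} →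
        MonotoneGate gt → Monotone C → Monotone (gt ∷ C)

{-# OPTIONS --safe #-}
module Submission where

-- Upper bound: eliminate the bags of an optimal tree decomposition from the last to the first.
-- The table of a bag B has one gate for each of the n^|B| assignments of B; when B is removed,
-- the vertices that occur in no remaining bag are summed out and the resulting table, which
-- involves only vertices of the parent bag, is multiplied into the parent's table.
--
-- Lower bound: cut a set of vertices of K_n into k colour classes of size n/k, and consider for
-- f : [k] → [n/k] the homomorphism sending i to the f(i)-th vertex of colour i.  By monotonicity
-- a parse tree of its monomial splits the monomial again and again into factors; at a
-- factorisation αρq the vertices of H met by at least two of α, ρ, q form a bag, and these bags
-- form a tree decomposition of H.  So some wire of the circuit carries a bag with more than tw(H)
-- vertices.  Two maps f, f' that yield the same wire and the same vertex sets agree on the bag: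
-- exchanging α for α' gives a monomial of some homomorphism ψ, which must meet every colour
-- exactly once.  Hence each wire accounts for O(n^(k - tw(H) - 1)) of the (n/k)^k maps.

open import Defs hiding (sym)
open import Algebra.Apartness.Properties.HeytingCommutativeRing using (x#0y#0→xy#0)
open import Algebra.Bundles using (CommutativeMonoid)
import Algebra.Properties.CommutativeMonoid.Sum as Prod
open import Data.Bool using (Bool; true; false; T; _∧_; if_then_else_)
open import Data.Fin using (Fin; zero; suc; toℕ; fromℕ<; punchIn; punchOut; inject≤; combine; remQuot; finToFun; funToFin; splitAt; join; _↑ˡ_; _↑ʳ_; _≟_)
import Data.Fin as Fin
import Data.Fin.Properties as Fin
open import Data.Fin.Subset using (Subset; _∈_; _∉_; _⊆_; _-_; _∩_; _∪_; ∁; ⊥; ∣_∣; ⁅_⁆; inside; outside)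
open import Data.Fin.Subset.Properties using (_∈?_; nonempty?; x∈p∩q⁺; x∈p∩q⁻; x∈p∪q⁺; x∈p∪q⁻; p─q⊆p; ∣p─q∣≤∣p∣; x∈p∧x≢y⇒x∈p-y; x∈p⇒∣p-x∣<∣p∣; x∉p⇒x∈∁p; ∣∁p∣≡n∸∣p∣; ∣p∣≤n; Empty-unique; ∣⊥∣≡0)
open import Data.List using (List; []; _∷_; _++_; map; concatMap; foldr; length; allFin; filter)
import Data.List as List
open import Data.List.Membership.Propositional using (find; lose) renaming (_∈_ to _∈ˡ_; _∉_ to _∉ˡ_)
open import Data.List.Membership.Propositional.Properties using (∈-map⁺; ∈-map⁻; ∈-++⁺ˡ; ∈-++⁺ʳ; ∈-concatMap⁺; ∈-concatMap⁻; ∈-allFin; ∈-filter⁺; ∈-filter⁻)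
import Data.List.Properties as List
open import Data.List.Relation.Binary.Permutation.Propositional as ↭ using (_↭_)
open import Data.List.Relation.Binary.Permutation.Propositional.Properties using (shift)
open import Data.List.Relation.Binary.Subset.Propositional using () renaming (_⊆_ to _⊆ˡ_)
open import Data.List.Relation.Unary.All as All using (All; []; _∷_)
import Data.List.Relation.Unary.All.Properties as All
open import Data.List.Relation.Unary.AllPairs using ([]; _∷_)
open import Data.List.Relation.Unary.Any as Any using (Any; here; there)
import Data.List.Relation.Unary.Any.Properties as Any
open import Data.List.Relation.Unary.Unique.Propositional using (Unique)
import Data.List.Relation.Unary.Unique.Propositional.Properties as Unique
open import Data.Nat using (ℕ; zero; suc; _+_; _*_; _^_; _∸_; _⊔_; _≤_; _<_; _≤?_; _<?_; z≤n; s≤s; NonZero)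
open import Data.Nat.DivMod using (_/_; _%_; m/n*n≤m; m≡m%n+[m/n]*n; m%n<n; /-monoˡ-≤; m*n/n≡m)
import Data.Nat.Properties as ℕ
open import Data.Product using (Σ; ∃; _×_; _,_; proj₁; proj₂)
open import Data.Rational as ℚ using (ℚ; 0ℚ; 1ℚ)
import Data.Rational.Properties as ℚ
open import Data.Sum using (_⊎_; inj₁; inj₂; [_,_]′)
open import Data.Unit using (tt)
open import Data.Vec using (Vec; []; _∷_; lookup; tabulate; there)
open import Data.Vec.Functional using (updateAt; removeAt) renaming (_∷_ to _∷ᶠ_)
open import Data.Vec.Functional.Properties using (updateAt-updates; updateAt-minimal)
import Data.Vec.Properties as Vec
open import Function using (_∘_)
open import Level using (0ℓ)
open import Relation.Binary.Definitions using (tri<; tri≈; tri>)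
open import Relation.Binary.PropositionalEquality
open import Relation.Nullary using (Dec; ¬_; does; yes; no; contradiction)
open import Relation.Nullary.Decidable using (¬?; _×-dec_; dec-true)
open import Relation.Unary using (Pred; Decidable)

-- Polynomials up to equality of coefficients

-- Colours are needed because `HomPoly` also contains the monomials of non-injective homomorphisms,
-- and exchanging factors between two parse trees might produce one of those. The exchange has force
-- only if the mixed monomial is seen to meet all k colours, and for this the factors of both maps
-- must occupy the same vertices of H. Hence these vertex sets are recorded in a label, at the price
-- of a factor that depends on k alone.
--
-- Size counts wires and a product gate may have any fan-in. A product is therefore split one child
-- at a time: each wire stands for the binary product of its child with the children after it, which
-- assigns bags to wires without adding gates.
--
-- For k = 1 the polynomial is the constant n, which a circuit without wires computes. For 2 ≤ k
-- connectivity puts every vertex on an edge, and only through its edges is a vertex visible in a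
-- monomial.
--
-- In the upper bound the elimination is carried out on terms, before n is chosen; their cost in
-- units of n^w wires is the constant.

*M-assoc : ∀ {n} (a b c : Mono n) → (a *M b) *M c ≡ a *M (b *M c)
*M-assoc = Vec.zipWith-assoc (Vec.zipWith-assoc ℕ.+-assoc)

*M-comm : ∀ {n} (a b : Mono n) → a *M b ≡ b *M a
*M-comm = Vec.zipWith-comm (Vec.zipWith-comm ℕ.+-comm)

*M-identityˡ : ∀ {n} (a : Mono n) → oneM *M a ≡ a
*M-identityˡ = Vec.zipWith-identityˡ (Vec.zipWith-identityˡ ℕ.+-identityˡ)

*M-identityʳ : ∀ {n} (a : Mono n) → a *M oneM ≡ a
*M-identityʳ = Vec.zipWith-identityʳ (Vec.zipWith-identityʳ ℕ.+-identityʳ)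

-- Pairing with arbitrary w, not just with indicators of monomials, makes the
-- compatibility of ≋ with products immediate.
⟨_,_⟩ : ∀ {n} → Poly n → (Mono n → ℚ) → ℚ
⟨ []          , w ⟩ = 0ℚ
⟨ (c , μ) ∷ p , w ⟩ = c ℚ.* w μ ℚ.+ ⟨ p , w ⟩

infix 4 _≋_
record _≋_ {n} (p q : Poly n) : Set where
  constructor mk≋
  field pairing : ∀ w → ⟨ p , w ⟩ ≡ ⟨ q , w ⟩
open _≋_ public

-- The coefficient of μ is the pairing with the indicator of μ.
≋⇒≈P : ∀ {n} {p q : Poly n} → p ≋ q → p ≈P q
≋⇒≈P {n} {p} {q} e μ = trans (coeff-pairing p) (trans (pairing e δ) (sym (coeff-pairing q)))
  where
  δ : Mono n → ℚ
  δ ν = if does (ν ≟M μ) then 1ℚ else 0ℚ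
  coeff-pairing : ∀ p → coeff p μ ≡ ⟨ p , δ ⟩
  coeff-pairing [] = refl
  coeff-pairing ((c , ν) ∷ p) with does (ν ≟M μ)
  ... | true  = cong₂ ℚ._+_ (sym (ℚ.*-identityʳ c)) (coeff-pairing p)
  ... | false = trans (coeff-pairing p)
                  (trans (sym (ℚ.+-identityˡ _)) (cong (ℚ._+ ⟨ p , δ ⟩) (sym (ℚ.*-zeroʳ c))))

≋-refl : ∀ {n} {p : Poly n} → p ≋ p
≋-refl = mk≋ λ w → refl

≋-reflexive : ∀ {n} {p q : Poly n} → p ≡ q → p ≋ q
≋-reflexive refl = ≋-refl

≋-sym : ∀ {n} {p q : Poly n} → p ≋ q → q ≋ p
≋-sym e = mk≋ λ w → sym (pairing e w)

≋-trans : ∀ {n} {p q r : Poly n} → p ≋ q → q ≋ r → p ≋ r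
≋-trans d e = mk≋ λ w → trans (pairing d w) (pairing e w)

pairing-congʷ : ∀ {n} (p : Poly n) {w w' : Mono n → ℚ} → w ≗ w' → ⟨ p , w ⟩ ≡ ⟨ p , w' ⟩
pairing-congʷ []            e = refl
pairing-congʷ ((c , μ) ∷ p) e = cong₂ ℚ._+_ (cong (c ℚ.*_) (e μ)) (pairing-congʷ p e)

pairing-++ : ∀ {n} (p q : Poly n) w → ⟨ p ++ q , w ⟩ ≡ ⟨ p , w ⟩ ℚ.+ ⟨ q , w ⟩
pairing-++ []            q w = sym (ℚ.+-identityˡ _)
pairing-++ ((c , μ) ∷ p) q w =
  trans (cong (c ℚ.* w μ ℚ.+_) (pairing-++ p q w)) (sym (ℚ.+-assoc (c ℚ.* w μ) _ _))

pairing-scale : ∀ {n} c μ (q : Poly n) w →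
  ⟨ map (λ r → c ℚ.* proj₁ r , μ *M proj₂ r) q , w ⟩ ≡ c ℚ.* ⟨ q , (λ ν → w (μ *M ν)) ⟩
pairing-scale c μ []            w = sym (ℚ.*-zeroʳ c)
pairing-scale c μ ((d , ν) ∷ q) w =
  trans (cong₂ ℚ._+_ (ℚ.*-assoc c d _) (pairing-scale c μ q w)) (sym (ℚ.*-distribˡ-+ c _ _))

-- The second factor enters only through pairings with shifted weights, and the first only through
-- the weight so obtained. The laws of the product follow from this.
pairing-* : ∀ {n} (p q : Poly n) w → ⟨ p *P q , w ⟩ ≡ ⟨ p , (λ μ → ⟨ q , (λ ν → w (μ *M ν)) ⟩) ⟩
pairing-* []            q w = refl
pairing-* ((c , μ) ∷ p) q w =
  trans (pairing-++ (map (λ r → c ℚ.* proj₁ r , μ *M proj₂ r) q) (p *P q) w)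
        (cong₂ ℚ._+_ (pairing-scale c μ q w) (pairing-* p q w))

+-interchange : ∀ a b c d → (a ℚ.+ b) ℚ.+ (c ℚ.+ d) ≡ (a ℚ.+ c) ℚ.+ (b ℚ.+ d)
+-interchange a b c d = begin
  (a ℚ.+ b) ℚ.+ (c ℚ.+ d) ≡⟨ ℚ.+-assoc a b (c ℚ.+ d) ⟩
  a ℚ.+ (b ℚ.+ (c ℚ.+ d)) ≡⟨ cong (a ℚ.+_) (sym (ℚ.+-assoc b c d)) ⟩
  a ℚ.+ ((b ℚ.+ c) ℚ.+ d) ≡⟨ cong (λ x → a ℚ.+ (x ℚ.+ d)) (ℚ.+-comm b c) ⟩
  a ℚ.+ ((c ℚ.+ b) ℚ.+ d) ≡⟨ cong (a ℚ.+_) (ℚ.+-assoc c b d) ⟩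
  a ℚ.+ (c ℚ.+ (b ℚ.+ d)) ≡⟨ sym (ℚ.+-assoc a c (b ℚ.+ d)) ⟩
  (a ℚ.+ c) ℚ.+ (b ℚ.+ d) ∎
  where open ≡-Reasoning

pairing-+ : ∀ {n} (p : Poly n) w w' → ⟨ p , (λ μ → w μ ℚ.+ w' μ) ⟩ ≡ ⟨ p , w ⟩ ℚ.+ ⟨ p , w' ⟩
pairing-+ []            w w' = refl
pairing-+ ((c , μ) ∷ p) w w' =
  trans (cong₂ ℚ._+_ (ℚ.*-distribˡ-+ c _ _) (pairing-+ p w w')) (+-interchange (c ℚ.* w μ) _ _ _)

pairing-*ˡ : ∀ {n} (p : Poly n) c w → ⟨ p , (λ μ → c ℚ.* w μ) ⟩ ≡ c ℚ.* ⟨ p , w ⟩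
pairing-*ˡ []            c w = sym (ℚ.*-zeroʳ c)
pairing-*ˡ ((d , μ) ∷ p) c w =
  trans (cong₂ ℚ._+_ (trans (sym (ℚ.*-assoc d c _)) (trans (cong (ℚ._* w μ) (ℚ.*-comm d c)) (ℚ.*-assoc c d _)))
                   (pairing-*ˡ p c w))
        (sym (ℚ.*-distribˡ-+ c _ _))

pairing-0 : ∀ {n} (p : Poly n) → ⟨ p , (λ _ → 0ℚ) ⟩ ≡ 0ℚ
pairing-0 []            = refl
pairing-0 ((c , μ) ∷ p) = trans (cong₂ ℚ._+_ (ℚ.*-zeroʳ c) (pairing-0 p)) (ℚ.+-identityˡ 0ℚ)

-- A change of the order of summation, to which commutativity of the product comes down.
pairing-fubini : ∀ {n} (p q : Poly n) (w : Mono n → Mono n → ℚ) →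
  ⟨ p , (λ μ → ⟨ q , w μ ⟩) ⟩ ≡ ⟨ q , (λ ν → ⟨ p , (λ μ → w μ ν) ⟩) ⟩
pairing-fubini []            q w = sym (pairing-0 q)
pairing-fubini ((c , μ) ∷ p) q w =
  trans (cong₂ ℚ._+_ (sym (pairing-*ˡ q c (w μ))) (pairing-fubini p q w))
        (sym (pairing-+ q (λ ν → c ℚ.* w μ ν) _))

*P-cong : ∀ {n} {p p' q q' : Poly n} → p ≋ p' → q ≋ q' → p *P q ≋ p' *P q'
*P-cong {p = p} {p'} {q} {q'} d e = mk≋ λ w →
  trans (pairing-* p q w)
    (trans (pairing-congʷ p (λ μ → pairing e _))
      (trans (pairing d _) (sym (pairing-* p' q' w))))

*P-comm : ∀ {n} (p q : Poly n) → p *P q ≋ q *P p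
*P-comm p q = mk≋ λ w →
  trans (pairing-* p q w)
    (trans (pairing-fubini p q _)
      (trans (pairing-congʷ q (λ ν → pairing-congʷ p (λ μ → cong w (*M-comm μ ν))))
        (sym (pairing-* q p w))))

*P-assoc : ∀ {n} (p q r : Poly n) → (p *P q) *P r ≋ p *P (q *P r)
*P-assoc p q r = mk≋ λ w →
  trans (pairing-* (p *P q) r w)
    (trans (pairing-* p q _)
      (trans (pairing-congʷ p (λ μ →
                trans (pairing-congʷ q (λ ν → pairing-congʷ r (λ ξ → cong w (*M-assoc μ ν ξ))))
                      (sym (pairing-* q r _))))
        (sym (pairing-* p (q *P r) w))))

*P-identityˡ : ∀ {n} (p : Poly n) → oneP *P p ≋ p
*P-identityˡ p = mk≋ λ w →
  trans (pairing-* oneP p w)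
    (trans (ℚ.+-identityʳ _)
      (trans (ℚ.*-identityˡ _) (pairing-congʷ p (λ μ → cong w (*M-identityˡ μ)))))

*P-identityʳ : ∀ {n} (p : Poly n) → p *P oneP ≋ p
*P-identityʳ p = ≋-trans (*P-comm p oneP) (*P-identityˡ p)

*P-zeroʳ : ∀ {n} (p : Poly n) → p *P [] ≋ []
*P-zeroʳ p = *P-comm p []

*P-commutativeMonoid : ℕ → CommutativeMonoid 0ℓ 0ℓ
*P-commutativeMonoid n = record
  { Carrier = Poly n
  ; _≈_     = _≋_
  ; _∙_     = _*P_
  ; ε       = oneP
  ; isCommutativeMonoid = record
    { isMonoid = record
      { isSemigroup = record
        { isMagma = record
          { isEquivalence = record { refl = ≋-refl ; sym = ≋-sym ; trans = ≋-trans }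
          ; ∙-cong = *P-cong }
        ; assoc = *P-assoc }
      ; identity = *P-identityˡ , *P-identityʳ }
    ; comm = *P-comm } }

++-cong : ∀ {n} {p p' q q' : Poly n} → p ≋ p' → q ≋ q' → p ++ q ≋ p' ++ q'
++-cong {p = p} {p'} {q} {q'} d e = mk≋ λ w →
  trans (pairing-++ p q w) (trans (cong₂ ℚ._+_ (pairing d w) (pairing e w)) (sym (pairing-++ p' q' w)))

concatMap-≋ : ∀ {A : Set} {n} {F G : A → Poly n} → (∀ x → F x ≋ G x) →
  ∀ xs → concatMap F xs ≋ concatMap G xs
concatMap-≋ e []       = ≋-refl
concatMap-≋ e (x ∷ xs) = ++-cong (e x) (concatMap-≋ e xs)

concatMap-*ʳ : ∀ {A : Set} {n} (F : A → Poly n) r xs →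
  concatMap (λ x → F x *P r) xs ≋ concatMap F xs *P r
concatMap-*ʳ F r []       = ≋-refl
concatMap-*ʳ F r (x ∷ xs) = mk≋ λ w →
  trans (pairing-++ (F x *P r) _ w)
    (trans (cong₂ ℚ._+_ (pairing-* (F x) r w)
                      (trans (pairing (concatMap-*ʳ F r xs) w) (pairing-* (concatMap F xs) r w)))
      (trans (sym (pairing-++ (F x) (concatMap F xs) _)) (sym (pairing-* (F x ++ concatMap F xs) r w))))

concatMap-[] : ∀ {A : Set} {n} (ys : List A) → concatMap (λ _ → []) ys ≋ [] {A = ℚ × Mono n}
concatMap-[] []       = ≋-refl
concatMap-[] (y ∷ ys) = concatMap-[] ys

concatMap-distrib-++ : ∀ {A : Set} {n} (F G : A → Poly n) ys →
  concatMap (λ y → F y ++ G y) ys ≋ concatMap F ys ++ concatMap G ys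
concatMap-distrib-++ F G []       = ≋-refl
concatMap-distrib-++ F G (y ∷ ys) = mk≋ λ w → begin
  ⟨ (F y ++ G y) ++ concatMap (λ y → F y ++ G y) ys , w ⟩
    ≡⟨ pairing-++ (F y ++ G y) _ w ⟩
  ⟨ F y ++ G y , w ⟩ ℚ.+ ⟨ concatMap (λ y → F y ++ G y) ys , w ⟩
    ≡⟨ cong₂ ℚ._+_ (pairing-++ (F y) (G y) w)
                 (trans (pairing (concatMap-distrib-++ F G ys) w) (pairing-++ (concatMap F ys) _ w)) ⟩
  (⟨ F y , w ⟩ ℚ.+ ⟨ G y , w ⟩) ℚ.+ (⟨ concatMap F ys , w ⟩ ℚ.+ ⟨ concatMap G ys , w ⟩)
    ≡⟨ +-interchange ⟨ F y , w ⟩ _ _ _ ⟩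
  (⟨ F y , w ⟩ ℚ.+ ⟨ concatMap F ys , w ⟩) ℚ.+ (⟨ G y , w ⟩ ℚ.+ ⟨ concatMap G ys , w ⟩)
    ≡⟨ sym (cong₂ ℚ._+_ (pairing-++ (F y) _ w) (pairing-++ (G y) _ w)) ⟩
  ⟨ F y ++ concatMap F ys , w ⟩ ℚ.+ ⟨ G y ++ concatMap G ys , w ⟩
    ≡⟨ sym (pairing-++ (F y ++ concatMap F ys) _ w) ⟩
  ⟨ (F y ++ concatMap F ys) ++ (G y ++ concatMap G ys) , w ⟩ ∎
  where open ≡-Reasoning

concatMap-comm : ∀ {A B : Set} {n} (F : A → B → Poly n) xs ys →
  concatMap (λ x → concatMap (F x) ys) xs ≋ concatMap (λ y → concatMap (λ x → F x y) xs) ys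
concatMap-comm F []       ys = ≋-sym (concatMap-[] ys)
concatMap-comm F (x ∷ xs) ys =
  ≋-trans (++-cong ≋-refl (concatMap-comm F xs ys))
          (≋-sym (concatMap-distrib-++ (F x) (λ y → concatMap (λ x → F x y) xs) ys))

-- Monotone circuits for sum-product terms

-- The values of f on B are the digits of a number in base n. The code indexes the gates of a table,
-- and later counts the values of a map outside a bag.
encode : ∀ {k n} (B : Subset k) → (Fin k → Fin n) → Fin (n ^ ∣ B ∣)
encode []            f = zero
encode (inside  ∷ B) f = combine (f zero) (encode B (f ∘ suc))
encode (outside ∷ B) f = encode B (f ∘ suc)

-- The default d fills the vertices outside B, where a table with scope B does not look.
decode : ∀ {k n} → Fin n → (B : Subset k) → Fin (n ^ ∣ B ∣) → Fin k → Fin n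
decode {n = n} d (inside  ∷ B) l zero    = proj₁ (remQuot {n} (n ^ ∣ B ∣) l)
decode {n = n} d (inside  ∷ B) l (suc i) = decode d B (proj₂ (remQuot {n} (n ^ ∣ B ∣) l)) i
decode         d (outside ∷ B) l zero    = d
decode         d (outside ∷ B) l (suc i) = decode d B l i

decode-encode : ∀ {k n} (d : Fin n) (B : Subset k) f i → i ∈ B → decode d B (encode B f) i ≡ f i
decode-encode d (inside  ∷ B) f zero    _ =
  cong proj₁ (Fin.remQuot-combine (f zero) (encode B (f ∘ suc)))
decode-encode d (inside  ∷ B) f (suc i) (there i∈B) =
  trans (cong (λ x → decode d B (proj₂ x) i) (Fin.remQuot-combine (f zero) (encode B (f ∘ suc))))
        (decode-encode d B (f ∘ suc) i i∈B)
decode-encode d (outside ∷ B) f (suc i) (there i∈B) = decode-encode d B (f ∘ suc) i i∈B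

infixl 7 _[_≔_]
_[_≔_] : ∀ {k n} → (Fin k → Fin n) → Fin k → Fin n → Fin k → Fin n
f [ v ≔ a ] = updateAt f v (λ _ → a)

≔-cong : ∀ {k n} {f f' : Fin k → Fin n} v a i → (i ≢ v → f i ≡ f' i) → (f [ v ≔ a ]) i ≡ (f' [ v ≔ a ]) i
≔-cong {f = f} {f'} v a i e with i ≟ v
... | yes refl = trans (updateAt-updates v f) (sym (updateAt-updates v f'))
... | no i≢v   = trans (updateAt-minimal i v f i≢v) (trans (e i≢v) (sym (updateAt-minimal i v f' i≢v)))

-- A gate index counts back from the newest gate, so each new gate renames all earlier ones; `old`
-- is this renaming, and c bounds the number of added wires.
record Extension {n g} (C : Circuit n g) (c : ℕ) : Set where
  field
    {gates}   : ℕ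
    circuit   : Circuit n gates
    old       : Fin g → Fin gates
    old-val   : ∀ i → lookup (evalAll circuit) (old i) ≡ lookup (evalAll C) i
    monotone  : Monotone C → Monotone circuit
    size≤     : size circuit ≤ size C + c
open Extension

ext-refl : ∀ {n g} {C : Circuit n g} → Extension C 0
ext-refl {C = C} = record
  { circuit = C ; old = λ i → i ; old-val = λ _ → refl ; monotone = λ m → m
  ; size≤ = ℕ.≤-reflexive (sym (ℕ.+-identityʳ (size C))) }

ext-trans : ∀ {n g c d} {C : Circuit n g} (E : Extension C c) → Extension (circuit E) d → Extension C (c + d)
ext-trans {c = c} {d} {C} E F = record
  { circuit = circuit F ; old = old F ∘ old E
  ; old-val = λ i → trans (old-val F (old E i)) (old-val E i)
  ; monotone = monotone F ∘ monotone E
  ; size≤ = ℕ.≤-trans (size≤ F) (ℕ.≤-trans (ℕ.+-monoˡ-≤ d (size≤ E)) (ℕ.≤-reflexive (ℕ.+-assoc (size C) c d))) }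

ext-weaken : ∀ {n g c d} {C : Circuit n g} → c ≤ d → Extension C c → Extension C d
ext-weaken {C = C} c≤d E = record
  { circuit = circuit E ; old = old E ; old-val = old-val E ; monotone = monotone E
  ; size≤ = ℕ.≤-trans (size≤ E) (ℕ.+-monoʳ-≤ (size C) c≤d) }

mapGate : ∀ {n g g'} → (Fin g → Fin g') → Gate n g → Gate n g'
mapGate σ (var u v u≢v) = var u v u≢v
mapGate σ (const q)     = const q
mapGate σ (plus is)     = plus (map σ is)
mapGate σ (times is)    = times (map σ is)

module _ {n g g' : ℕ} (σ : Fin g → Fin g') where

  fanIn-mapGate : ∀ (gt : Gate n g) → fanIn (mapGate σ gt) ≡ fanIn gt
  fanIn-mapGate (var u v x) = refl
  fanIn-mapGate (const x)   = refl
  fanIn-mapGate (plus is)   = List.length-map σ is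
  fanIn-mapGate (times is)  = List.length-map σ is

  monotone-mapGate : ∀ (gt : Gate n g) → MonotoneGate gt → MonotoneGate (mapGate σ gt)
  monotone-mapGate (var u v x) m = m
  monotone-mapGate (const x)   m = m
  monotone-mapGate (plus is)   m = m
  monotone-mapGate (times is)  m = m

  gateVal-mapGate : ∀ (gt : Gate n g) {vs : Vec (Poly n) g} {vs' : Vec (Poly n) g'} →
    (∀ i → lookup vs' (σ i) ≡ lookup vs i) → gateVal (mapGate σ gt) vs' ≡ gateVal gt vs
  gateVal-mapGate (var u v x) e = refl
  gateVal-mapGate (const x)   e = refl
  gateVal-mapGate (plus is)   e =
    cong (foldr _+P_ []) (trans (sym (List.map-∘ is)) (List.map-cong e is))
  gateVal-mapGate (times is)  e =
    cong (foldr _*P_ oneP) (trans (sym (List.map-∘ is)) (List.map-cong e is))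

-- The gates of a layer read from C and never from one another.
record Layer {n g} (C : Circuit n g) {L : ℕ} (gs : Fin L → Gate n g) (c : ℕ) : Set where
  field
    ext     : Extension C c
    new     : Fin L → Fin (gates ext)
    new-val : ∀ l → lookup (evalAll (circuit ext)) (new l) ≡ gateVal (gs l) (evalAll C)

addLayer : ∀ {n g} (C : Circuit n g) {L} (gs : Fin L → Gate n g) d →
  (∀ l → MonotoneGate (gs l)) → (∀ l → fanIn (gs l) ≤ d) → Layer C gs (L * d)
addLayer C {zero}  gs d mono fan = record { ext = ext-refl ; new = λ () ; new-val = λ () }
addLayer C {suc L} gs d mono fan = record
  { ext = record
    { circuit  = top ∷ circuit ext
    ; old      = suc ∘ old ext
    ; old-val  = old-val ext
    ; monotone = λ m → monotone-mapGate (old ext) (gs zero) (mono zero) ∷ monotone ext m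
    ; size≤    = begin
        fanIn top + size (circuit ext) ≡⟨ cong (_+ size (circuit ext)) (fanIn-mapGate (old ext) (gs zero)) ⟩
        fanIn (gs zero) + size (circuit ext) ≤⟨ ℕ.+-mono-≤ (fan zero) (size≤ ext) ⟩
        d + (size C + L * d)           ≡⟨ sym (ℕ.+-assoc d (size C) (L * d)) ⟩
        (d + size C) + L * d           ≡⟨ cong (_+ L * d) (ℕ.+-comm d (size C)) ⟩
        (size C + d) + L * d           ≡⟨ ℕ.+-assoc (size C) d (L * d) ⟩
        size C + (d + L * d)           ∎ }
  ; new     = λ { zero → zero ; (suc l) → suc (new l) }
  ; new-val = λ { zero → gateVal-mapGate (old ext) (gs zero) (old-val ext) ; (suc l) → new-val l } }
  where
  open Layer (addLayer C (gs ∘ suc) d (mono ∘ suc) (fan ∘ suc))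
  open ℕ.≤-Reasoning
  top = mapGate (old ext) (gs zero)

-- The index B is the scope: the value depends on the assignment only through B. The bound by w is
-- imposed exactly where a gate table will need wires.
data Term {k : ℕ} (w : ℕ) : Subset k → Set where
  one    : ∀ {B} → Term w B
  edge   : ∀ {B} i j → i ∈ B → j ∈ B → Term w B
  mul    : ∀ {B} → ∣ B ∣ ≤ w → Term w B → Term w B → Term w B
  weaken : ∀ {B B'} → B ⊆ B' → Term w B → Term w B'
  sum    : ∀ {B} v → v ∈ B → ∣ B ∣ ≤ w → Term w B → Term w (B - v)

-- It vanishes when the two ends coincide, so that a sum over all maps is already a sum over
-- homomorphisms.
edgeP : ∀ {k n} → (Fin k → Fin n) → Fin k → Fin k → Poly n
edgeP f i j with f i ≟ f j
... | yes _ = []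
... | no  _ = (1ℚ , varM (f i) (f j)) ∷ []

⟦_⟧ : ∀ {k w n} {B : Subset k} → Term w B → (Fin k → Fin n) → Poly n
⟦ one          ⟧ f = oneP
⟦ edge i j _ _ ⟧ f = edgeP f i j
⟦ mul _ σ τ    ⟧ f = ⟦ σ ⟧ f *P ⟦ τ ⟧ f
⟦ weaken _ τ   ⟧ f = ⟦ τ ⟧ f
⟦ sum v _ _ τ  ⟧ f = concatMap (λ a → ⟦ τ ⟧ (f [ v ≔ a ])) (allFin _)

-- The unit is n^w wires, which keeps the cost independent of n. The 2 in `mul` is the fan-in of its
-- gates.
cost : ∀ {k w} {B : Subset k} → Term w B → ℕ
cost one            = 0
cost (edge i j _ _) = 0
cost (mul _ σ τ)    = cost σ + (cost τ + 2)
cost (weaken _ τ)   = cost τ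
cost (sum v _ _ τ)  = cost τ + 1

edgeP-cong : ∀ {k n} {f f' : Fin k → Fin n} i j → f i ≡ f' i → f j ≡ f' j → edgeP f i j ≡ edgeP f' i j
edgeP-cong {f = f} {f'} i j ei ej with f i ≟ f j | f' i ≟ f' j
... | yes _ | yes _ = refl
... | yes e | no ne = contradiction (trans (sym ei) (trans e ej)) ne
... | no ne | yes e = contradiction (trans ei (trans e (sym ej))) ne
... | no _  | no _  = cong₂ (λ x y → (1ℚ , varM x y) ∷ []) ei ej

-- In the case of `sum` every summand overwrites the value at v, so v may leave the scope.
⟦⟧-local : ∀ {k w n} {B : Subset k} (τ : Term w B) {f f' : Fin k → Fin n} →
  (∀ i → i ∈ B → f i ≡ f' i) → ⟦ τ ⟧ f ≡ ⟦ τ ⟧ f'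
⟦⟧-local one            e = refl
⟦⟧-local (edge i j p q) e = edgeP-cong i j (e i p) (e j q)
⟦⟧-local (mul _ σ τ)    e = cong₂ _*P_ (⟦⟧-local σ e) (⟦⟧-local τ e)
⟦⟧-local (weaken s τ)   e = ⟦⟧-local τ (λ i i∈B → e i (s i∈B))
⟦⟧-local (sum v _ _ τ)  e =
  List.concatMap-cong (λ a → ⟦⟧-local τ (λ i i∈B → ≔-cong v a i (λ i≢v → e i (x∈p∧x≢y⇒x∈p-y i∈B i≢v)))) (allFin _)

edgeGate : ∀ {k n g} → (Fin k → Fin n) → Fin k → Fin k → Gate n g
edgeGate f i j with f i ≟ f j
-- The empty sum is the zero polynomial and has no wires.
... | yes _ = plus []
... | no ne = var (f i) (f j) ne

module _ {k n g : ℕ} (f : Fin k → Fin n) (i j : Fin k) where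

  edgeGate-val : (vs : Vec (Poly n) g) → gateVal (edgeGate f i j) vs ≡ edgeP f i j
  edgeGate-val vs with f i ≟ f j
  ... | yes _ = refl
  ... | no _  = refl

  edgeGate-fanIn : fanIn (edgeGate {g = g} f i j) ≤ 0
  edgeGate-fanIn with f i ≟ f j
  ... | yes _ = z≤n
  ... | no _  = z≤n

  edgeGate-monotone : MonotoneGate (edgeGate {g = g} f i j)
  edgeGate-monotone with f i ≟ f j
  ... | yes _ = tt
  ... | no _  = tt

record Table {k n g} (C : Circuit n g) (F : (Fin k → Fin n) → Poly n) (c : ℕ) : Set where
  field
    ext     : Extension C c
    tab     : (Fin k → Fin n) → Fin (gates ext)
    tab-val : ∀ f → lookup (evalAll (circuit ext)) (tab f) ≋ F f

-- One gate per assignment of B suffices, as F depends only on the values on B.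
layerTable : ∀ {k n g} (d₀ : Fin n) {C : Circuit n g} (B : Subset k) {F : (Fin k → Fin n) → Poly n}
  (gs : (Fin k → Fin n) → Gate n g) d {c} → n ^ ∣ B ∣ * d ≤ c →
  (∀ f → MonotoneGate (gs f)) → (∀ f → fanIn (gs f) ≤ d) →
  (∀ {f f'} → (∀ i → i ∈ B → f i ≡ f' i) → F f ≡ F f') →
  (∀ f → gateVal (gs f) (evalAll C) ≋ F f) → Table C F c
layerTable d₀ {C} B gs d le mono fan loc val = record
  { ext     = ext-weaken le ext
  ; tab     = new ∘ encode B
  ; tab-val = λ f → ≋-trans (≋-reflexive (new-val (encode B f)))
                (≋-trans (val _) (≋-reflexive (loc (decode-encode d₀ B f)))) }
  where open Layer (addLayer C (gs ∘ decode d₀ B) d (λ _ → mono _) (λ _ → fan _))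

thenTable : ∀ {k n g c d} {C : Circuit n g} {F : (Fin k → Fin n) → Poly n} (E : Extension C c) →
  Table (circuit E) F d → Table C F (c + d)
thenTable E T = record { ext = ext-trans E (Table.ext T) ; tab = Table.tab T ; tab-val = Table.tab-val T }

subst-cost : ∀ {k n g c d} {C : Circuit n g} {F : (Fin k → Fin n) → Poly n} → c ≡ d → Table C F c → Table C F d
subst-cost refl T = T

module _ {k w n : ℕ} .{{_ : NonZero n}} (d₀ : Fin n) where

  build : ∀ {g} {B : Subset k} (τ : Term w B) (C : Circuit n g) → Table C ⟦ τ ⟧ (cost τ * n ^ w)
  build one C = record
    { ext     = ext
    ; tab     = λ _ → new zero
    ; tab-val = λ _ → ≋-reflexive (new-val zero) }
    where open Layer (addLayer C {1} (λ _ → times []) 0 (λ _ → tt) (λ _ → z≤n))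
  build {B = B} τ@(edge i j _ _) C =
    layerTable d₀ B (λ f → edgeGate f i j) 0 (ℕ.≤-reflexive (ℕ.*-zeroʳ (n ^ ∣ B ∣)))
      (λ f → edgeGate-monotone f i j) (λ f → edgeGate-fanIn f i j)
      (⟦⟧-local τ) (λ f → ≋-reflexive (edgeGate-val f i j (evalAll C)))
  build {B = B} τ@(mul B≤w σ₁ σ₂) C =
    subst-cost
      (trans (cong (cost σ₁ * n ^ w +_) (sym (ℕ.*-distribʳ-+ (n ^ w) (cost σ₂) 2)))
             (sym (ℕ.*-distribʳ-+ (n ^ w) (cost σ₁) _)))
      (thenTable T₁.ext (thenTable T₂.ext
        (layerTable d₀ B
          (λ f → times (old T₂.ext (T₁.tab f) ∷ T₂.tab f ∷ [])) 2
          (ℕ.≤-trans (ℕ.≤-reflexive (ℕ.*-comm (n ^ ∣ B ∣) 2)) (ℕ.*-monoʳ-≤ 2 (ℕ.^-monoʳ-≤ n B≤w)))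
          (λ _ → tt) (λ _ → ℕ.≤-refl) (⟦⟧-local τ)
          (λ f → *P-cong (≋-trans (≋-reflexive (old-val T₂.ext (T₁.tab f))) (T₁.tab-val f))
                         (≋-trans (*P-identityʳ _) (T₂.tab-val f))))))
    where
    module T₁ = Table (build σ₁ C)
    module T₂ = Table (build σ₂ (circuit T₁.ext))
  build (weaken _ τ) C = build τ C
  build {B = B} τ@(sum {B₀} v v∈B B≤w σ) C =
    subst-cost (sym (ℕ.*-distribʳ-+ (n ^ w) (cost σ) 1))
      (thenTable T.ext
        (layerTable d₀ B
          (λ f → plus (map (λ a → T.tab (f [ v ≔ a ])) (allFin n))) n
          -- The summed vertex has left the scope, so the fan-in n makes up for a missing factor n
          -- in the number of gates.
          (begin
            n ^ ∣ B ∣ * n   ≡⟨ ℕ.*-comm (n ^ ∣ B ∣) n ⟩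
            n ^ suc ∣ B ∣   ≤⟨ ℕ.^-monoʳ-≤ n (ℕ.≤-trans (x∈p⇒∣p-x∣<∣p∣ v∈B) B≤w) ⟩
            n ^ w           ≡⟨ sym (ℕ.+-identityʳ (n ^ w)) ⟩
            1 * n ^ w       ∎)
          (λ _ → tt)
          (λ f → ℕ.≤-reflexive (trans (List.length-map _ (allFin n)) (List.length-tabulate {n = n} _)))
          (⟦⟧-local τ)
          (λ f → ≋-trans (≋-reflexive (cong (foldr _+P_ []) (sym (List.map-∘ (allFin n)))))
                         (concatMap-≋ (λ a → T.tab-val (f [ v ≔ a ])) (allFin n)))))
    where
    open ℕ.≤-Reasoning
    module T = Table (build σ C)

-- Iterated sums over the values of vertices

SumOver : ∀ {k n} → List (Fin k) → ((Fin k → Fin n) → Poly n) → (Fin k → Fin n) → Poly n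
SumOver []       F f = F f
SumOver (v ∷ vs) F f = concatMap (λ a → SumOver vs F (f [ v ≔ a ])) (allFin _)

-- Updates in a different order give assignments that agree only pointwise, so F has to respect
-- pointwise equality.
Extensional : ∀ {k n} → ((Fin k → Fin n) → Poly n) → Set
Extensional F = ∀ {f f'} → f ≗ f' → F f ≡ F f'

module _ {k n : ℕ} {F : (Fin k → Fin n) → Poly n} where

  SumOver-cong : ∀ {G : (Fin k → Fin n) → Poly n} vs → (∀ f → F f ≋ G f) → ∀ f → SumOver vs F f ≋ SumOver vs G f
  SumOver-cong []       e f = e f
  SumOver-cong (v ∷ vs) e f = concatMap-≋ (λ a → SumOver-cong vs e (f [ v ≔ a ])) (allFin n)

  SumOver-++ : ∀ vs ws f → SumOver (vs ++ ws) F f ≡ SumOver vs (SumOver ws F) f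
  SumOver-++ []       ws f = refl
  SumOver-++ (v ∷ vs) ws f = List.concatMap-cong (λ a → SumOver-++ vs ws (f [ v ≔ a ])) (allFin n)

  SumOver-ext : Extensional F → ∀ vs → Extensional (SumOver vs F)
  SumOver-ext ext []       e = ext e
  SumOver-ext ext (v ∷ vs) e =
    List.concatMap-cong (λ a → SumOver-ext ext vs (λ i → ≔-cong v a i (λ _ → e i))) (allFin n)

  -- Distributivity is what makes elimination cheap: summing out the private vertices of a bag
  -- touches the table of that bag alone.
  SumOver-*ʳ : ∀ {R : (Fin k → Fin n) → Poly n} vs →
    (∀ v → v ∈ˡ vs → ∀ f a → R (f [ v ≔ a ]) ≋ R f) →
    ∀ f → SumOver vs (λ g → F g *P R g) f ≋ SumOver vs F f *P R f
  SumOver-*ʳ []       ind f = ≋-refl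
  SumOver-*ʳ {R} (v ∷ vs) ind f =
    ≋-trans (concatMap-≋ (λ a → ≋-trans (SumOver-*ʳ vs (λ u u∈vs → ind u (there u∈vs)) (f [ v ≔ a ]))
                                        (*P-cong {p = SumOver vs F (f [ v ≔ a ])} ≋-refl (ind v (here refl) f a)))
                         (allFin n))
            (concatMap-*ʳ (λ a → SumOver vs F (f [ v ≔ a ])) (R f) (allFin n))

≔-comm : ∀ {k n} (f : Fin k → Fin n) {u v} → u ≢ v → ∀ a b →
  f [ u ≔ a ] [ v ≔ b ] ≗ f [ v ≔ b ] [ u ≔ a ]
≔-comm f {u} {v} u≢v a b i with i ≟ v
... | yes refl = trans (updateAt-updates v _)
                     (sym (trans (updateAt-minimal v u _ (u≢v ∘ sym)) (updateAt-updates v f)))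
... | no i≢v = trans (updateAt-minimal i v _ i≢v)
                 (≔-cong u a i (λ _ → sym (updateAt-minimal i v f i≢v)))

SumOver-↭ : ∀ {k n} {F : (Fin k → Fin n) → Poly n} → Extensional F →
  ∀ {vs ws} → vs ↭ ws → ∀ f → SumOver vs F f ≋ SumOver ws F f
SumOver-↭ ext ↭.refl        f = ≋-refl
SumOver-↭ ext (↭.prep v p)  f = concatMap-≋ (λ a → SumOver-↭ ext p (f [ v ≔ a ])) (allFin _)
SumOver-↭ ext (↭.trans p q) f = ≋-trans (SumOver-↭ ext p f) (SumOver-↭ ext q f)
SumOver-↭ {n = n} {F} ext (↭.swap {vs} {ws} u v p) f with u ≟ v
-- Exchanging a vertex with itself changes nothing; two updates commute only at distinct vertices.
... | yes refl =
  concatMap-≋ (λ a → concatMap-≋ (λ b → SumOver-↭ ext p (f [ u ≔ a ] [ u ≔ b ])) (allFin n)) (allFin n)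
... | no u≢v =
  ≋-trans
    (concatMap-≋ (λ a → concatMap-≋ (λ b →
       ≋-trans (≋-reflexive (SumOver-ext ext vs (≔-comm f u≢v a b))) (SumOver-↭ ext p _)) (allFin n)) (allFin n))
    (concatMap-comm (λ a b → SumOver ws F (f [ v ≔ b ] [ u ≔ a ])) (allFin n) (allFin n))

concatMap-concatMap : ∀ {A B C : Set} (F : B → List C) (G : A → List B) xs →
  concatMap F (concatMap G xs) ≡ concatMap (concatMap F ∘ G) xs
concatMap-concatMap F G []       = refl
concatMap-concatMap F G (x ∷ xs) =
  trans (List.concatMap-++ F (G x) _) (cong (concatMap F (G x) ++_) (concatMap-concatMap F G xs))

∷ᶠ-cong : ∀ {k n} (a : Fin n) {f f' : Fin k → Fin n} → f ≗ f' → (a ∷ᶠ f) ≗ (a ∷ᶠ f')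
∷ᶠ-cong a e zero    = refl
∷ᶠ-cong a e (suc i) = e i

SumOver-suc : ∀ {k n} {F : (Fin (suc k) → Fin n) → Poly n} → Extensional F → ∀ vs f →
  SumOver (map suc vs) F f ≡ SumOver vs (λ g → F (f zero ∷ᶠ g)) (f ∘ suc)
SumOver-suc ext []       f = ext λ { zero → refl ; (suc i) → refl }
SumOver-suc ext (v ∷ vs) f = List.concatMap-cong (λ a → SumOver-suc ext vs (f [ suc v ≔ a ])) (allFin _)

-- The sums overwrite the initial assignment at every vertex, so any f will do.
sum-allMaps : ∀ k {n} {F : (Fin k → Fin n) → Poly n} → Extensional F → ∀ f →
  concatMap F (allMaps k n) ≡ SumOver (allFin k) F f
sum-allMaps zero {F = F} ext f =
  trans (List.++-identityʳ _) (ext λ ())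
sum-allMaps (suc k) {n} {F} ext f = begin
  concatMap F (concatMap (λ a → map (a ∷ᶠ_) (allMaps k n)) (allFin n))
    ≡⟨ concatMap-concatMap F _ (allFin n) ⟩
  concatMap (λ a → concatMap F (map (a ∷ᶠ_) (allMaps k n))) (allFin n)
    ≡⟨ List.concatMap-cong (λ a → begin
         concatMap F (map (a ∷ᶠ_) (allMaps k n))
           ≡⟨ List.concatMap-map F (a ∷ᶠ_) (allMaps k n) ⟩
         concatMap (F ∘ (a ∷ᶠ_)) (allMaps k n)
           ≡⟨ sum-allMaps k (ext ∘ ∷ᶠ-cong a) (f ∘ suc) ⟩
         SumOver (allFin k) (F ∘ (a ∷ᶠ_)) (f ∘ suc)
           ≡⟨ sym (SumOver-suc ext (allFin k) (f [ zero ≔ a ])) ⟩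
         SumOver (map suc (allFin k)) F (f [ zero ≔ a ])
           ≡⟨ cong (λ vs → SumOver vs F (f [ zero ≔ a ])) (List.map-tabulate (λ i → i) suc) ⟩
         SumOver (List.tabulate suc) F (f [ zero ≔ a ]) ∎)
       (allFin n) ⟩
  concatMap (λ a → SumOver (List.tabulate suc) F (f [ zero ≔ a ])) (allFin n) ∎
  where open ≡-Reasoning

-- The homomorphism polynomial as a sum of products over edges

-- The enumeration repeats the one inside `homMono`, so that both products match factor by factor.
edgeList : ∀ {k} → Graph k → List (Fin k × Fin k)
edgeList {k} H = concatMap (λ i → concatMap (λ j →
  if adj H i j ∧ does (i Fin.<? j) then (i , j) ∷ [] else []) (allFin k)) (allFin k)

module _ {k : ℕ} (H : Graph k) where

  ∈-edgeList⁺ : ∀ i j → Adj H i j → i Fin.< j → (i , j) ∈ˡ edgeList H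
  ∈-edgeList⁺ i j a i<j =
    ∈-concatMap⁺ _ (lose (∈-allFin i) (∈-concatMap⁺ _ (lose (∈-allFin j) (mem _ _ a (ℕ.<⇒<ᵇ i<j)))))
    where
    mem : ∀ b c → T b → T c → (i , j) ∈ˡ (if b ∧ c then (i , j) ∷ [] else [])
    mem true true _ _ = here refl

  ∈-edgeList⁻ : ∀ {e} → e ∈ˡ edgeList H → Adj H (proj₁ e) (proj₂ e)
  ∈-edgeList⁻ {e} e∈ with find (∈-concatMap⁻ _ {xs = allFin k} e∈)
  ... | i , _ , e∈ᵢ with find (∈-concatMap⁻ _ {xs = allFin k} e∈ᵢ)
  ... | j , _ , e∈ᵢⱼ = mem (adj H i j) _ refl e∈ᵢⱼ
    where
    mem : ∀ b c → b ≡ adj H i j → e ∈ˡ (if b ∧ c then (i , j) ∷ [] else []) → Adj H (proj₁ e) (proj₂ e)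
    mem true true eq (here refl) = subst T eq tt

  homMono-edgeList : ∀ {n} (φ : Fin k → Fin n) →
    homMono H φ ≡ foldr _*M_ oneM (map (λ e → varM (φ (proj₁ e)) (φ (proj₂ e))) (edgeList H))
  homMono-edgeList {n} φ = cong (foldr _*M_ oneM) (sym (trans
    (List.map-concatMap v _ (allFin k))
    (List.concatMap-cong (λ i → trans (List.map-concatMap v _ (allFin k))
      (List.concatMap-cong (λ j → float i j (adj H i j ∧ does (i Fin.<? j))) (allFin k))) (allFin k))))
    where
    v : Fin k × Fin k → Mono n
    v e = varM (φ (proj₁ e)) (φ (proj₂ e))
    float : ∀ i j b → map v (if b then (i , j) ∷ [] else []) ≡ (if b then varM (φ i) (φ j) ∷ [] else [])
    float i j true  = refl
    float i j false = refl

edgesP : ∀ {k n} → List (Fin k × Fin k) → (Fin k → Fin n) → Poly n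
edgesP es f = foldr _*P_ oneP (map (λ e → edgeP f (proj₁ e) (proj₂ e)) es)

edgesP-ext : ∀ {k n} es → Extensional {k} {n} (edgesP es)
edgesP-ext es e = cong (foldr _*P_ oneP) (List.map-cong (λ { (i , j) → edgeP-cong i j (e i) (e j) }) es)

edgesP-proper : ∀ {k n} es (f : Fin k → Fin n) → All (λ e → f (proj₁ e) ≢ f (proj₂ e)) es →
  edgesP es f ≡ (1ℚ , foldr _*M_ oneM (map (λ e → varM (f (proj₁ e)) (f (proj₂ e))) es)) ∷ []
edgesP-proper []             f []         = refl
edgesP-proper ((i , j) ∷ es) f (ne ∷ nes) with f i ≟ f j
... | yes e = contradiction e ne
... | no _  = cong (((1ℚ , varM (f i) (f j)) ∷ []) *P_) (edgesP-proper es f nes)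

edgesP-improper : ∀ {k n} es (f : Fin k → Fin n) → Any (λ e → f (proj₁ e) ≡ f (proj₂ e)) es →
  edgesP es f ≋ []
edgesP-improper ((i , j) ∷ es) f (here e) with f i ≟ f j
... | yes _ = ≋-refl
... | no ne = contradiction e ne
edgesP-improper ((i , j) ∷ es) f (there e) =
  ≋-trans (*P-cong {p = edgeP f i j} ≋-refl (edgesP-improper es f e)) (*P-zeroʳ (edgeP f i j))

proper⇒IsHom : ∀ {k n} (H : Graph k) (f : Fin k → Fin n) →
  ¬ Any (λ e → f (proj₁ e) ≡ f (proj₂ e)) (edgeList H) → IsHom H f
proper⇒IsHom H f proper i j a e with Fin.<-cmp i j
... | tri< i<j _ _ = proper (lose (∈-edgeList⁺ H i j a i<j) e)
... | tri≈ _ refl _ = subst T (irrefl H i) a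
... | tri> _ _ j<i = proper (lose (∈-edgeList⁺ H j i (subst T (Graph.sym H i j) a) j<i) (sym e))

map-filter-≋ : ∀ {A : Set} {n} {P : Pred A 0ℓ} (P? : Decidable P) {g : A → _} {G : A → Poly n} →
  (∀ x → P x → (g x ∷ []) ≋ G x) → (∀ x → ¬ P x → [] ≋ G x) →
  ∀ xs → map g (filter P? xs) ≋ concatMap G xs
map-filter-≋ P? eY eN [] = ≋-refl
map-filter-≋ P? eY eN (x ∷ xs) with P? x
... | yes p = ++-cong (eY x p) (map-filter-≋ P? eY eN xs)
... | no ¬p = ++-cong (eN x ¬p) (map-filter-≋ P? eY eN xs)

HomPoly-≋ : ∀ {k} (H : Graph k) n (f : Fin k → Fin n) →
  HomPoly H n ≋ SumOver (allFin k) (edgesP (edgeList H)) f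
HomPoly-≋ {k} H n f =
  ≋-trans (map-filter-≋ (isHom? H) yesCase noCase (allMaps k n))
          (≋-reflexive (sum-allMaps k (edgesP-ext (edgeList H)) f))
  where
  yesCase : ∀ φ → IsHom H φ → ((1ℚ , homMono H φ) ∷ []) ≋ edgesP (edgeList H) φ
  yesCase φ hom = ≋-reflexive (trans (cong (λ μ → (1ℚ , μ) ∷ []) (homMono-edgeList H φ))
    (sym (edgesP-proper (edgeList H) φ (All.tabulate (λ e∈ → hom _ _ (∈-edgeList⁻ H e∈))))))
  noCase : ∀ φ → ¬ IsHom H φ → [] ≋ edgesP (edgeList H) φ
  noCase φ ¬hom with Any.any? (λ e → φ (proj₁ e) ≟ φ (proj₂ e)) (edgeList H)
  ... | yes im    = ≋-sym (edgesP-improper (edgeList H) φ im)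
  ... | no proper = contradiction (proper⇒IsHom H φ proper) ¬hom

-- Variable elimination along a tree decomposition

∏ : ∀ {m n} → (Fin m → Poly n) → Poly n
∏ {n = n} = Prod.sum (*P-commutativeMonoid n)

∏-cong : ∀ {m n} {F G : Fin m → Poly n} → (∀ t → F t ≋ G t) → ∏ F ≋ ∏ G
∏-cong {n = n} = Prod.sum-cong-≋ (*P-commutativeMonoid n)

∏-remove : ∀ {m n} (F : Fin (suc m) → Poly n) s → ∏ F ≋ F s *P ∏ (removeAt F s)
∏-remove {n = n} F s = Prod.sum-remove (*P-commutativeMonoid n) {i = s} F

∏-ones : ∀ m {n} {F : Fin m → Poly n} → (∀ t → F t ≋ oneP) → ∏ F ≋ oneP
∏-ones zero    e = ≋-refl
∏-ones (suc m) {F = F} e =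
  ≋-trans (*P-cong {p = F zero} (e zero) (∏-ones m {F = F ∘ suc} (e ∘ suc))) (*P-identityˡ oneP)

module _ {A : Set} {P : Pred A 0ℓ} (P? : Decidable P) where

  filter-split-↭ : ∀ xs → xs ↭ filter P? xs ++ filter (¬? ∘ P?) xs
  filter-split-↭ []       = ↭.refl
  filter-split-↭ (x ∷ xs) with P? x
  ... | yes _ = ↭.prep x (filter-split-↭ xs)
  ... | no _  = ↭.trans (↭.prep x (filter-split-↭ xs)) (↭.↭-sym (shift x (filter P? xs) _))

  filter-filter : ∀ {Q : Pred A 0ℓ} (Q? : Decidable Q) → (∀ x → P x → Q x) →
    ∀ xs → filter P? (filter Q? xs) ≡ filter P? xs
  filter-filter Q? imp []       = refl
  filter-filter Q? imp (x ∷ xs) with Q? x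
  ... | yes _ with P? x
  ...   | yes _ = cong (x ∷_) (filter-filter Q? imp xs)
  ...   | no _  = filter-filter Q? imp xs
  filter-filter Q? imp (x ∷ xs) | no ¬q with P? x
  ...   | yes p = contradiction (imp x p) ¬q
  ...   | no _  = filter-filter Q? imp xs

x∉p-x : ∀ {k} {x : Fin k} {p : Subset k} → x ∉ p - x
x∉p-x {x = zero}  {_ ∷ _} ()
x∉p-x {x = suc x} {_ ∷ p} (there h) = x∉p-x {p = p} h

-- The tail is removed first because the nested `sum` terms in `sums` remove vertices in this order.
_∖_ : ∀ {k} → Subset k → List (Fin k) → Subset k
B ∖ []       = B
B ∖ (v ∷ vs) = (B ∖ vs) - v

∖⊆ : ∀ {k} (B : Subset k) vs → B ∖ vs ⊆ B
∖⊆ B []       h = h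
∖⊆ B (v ∷ vs) h = ∖⊆ B vs (p─q⊆p (B ∖ vs) ⁅ v ⁆ h)

∈-∖⁺ : ∀ {k} {B : Subset k} {v} vs → v ∈ B → v ∉ˡ vs → v ∈ B ∖ vs
∈-∖⁺ []       v∈B v∉ = v∈B
∈-∖⁺ (u ∷ vs) v∈B v∉ = x∈p∧x≢y⇒x∈p-y (∈-∖⁺ vs v∈B (v∉ ∘ there)) (v∉ ∘ here)

∈-∖⁻ : ∀ {k} {B : Subset k} {v} vs → v ∈ B ∖ vs → v ∉ˡ vs
∈-∖⁻ {B = B} (u ∷ vs) h (here refl) = x∉p-x {p = B ∖ vs} h
∈-∖⁻ {B = B} (u ∷ vs) h (there v∈)  = ∈-∖⁻ vs (p─q⊆p (B ∖ vs) ⁅ u ⁆ h) v∈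

∣∖∣≤ : ∀ {k} (B : Subset k) vs → ∣ B ∖ vs ∣ ≤ ∣ B ∣
∣∖∣≤ B []       = ℕ.≤-refl
∣∖∣≤ B (v ∷ vs) = ℕ.≤-trans (∣p─q∣≤∣p∣ (B ∖ vs) ⁅ v ⁆) (∣∖∣≤ B vs)

sums : ∀ {k w} {B : Subset k} vs → Unique vs → All (_∈ B) vs → ∣ B ∣ ≤ w → Term w B → Term w (B ∖ vs)
sums []       _         _            _   τ = τ
sums (v ∷ vs) (v∉ ∷ uq) (v∈B ∷ vs∈B) B≤w τ =
  sum v (∈-∖⁺ vs v∈B (All.All¬⇒¬Any v∉)) (ℕ.≤-trans (∣∖∣≤ _ vs) B≤w) (sums vs uq vs∈B B≤w τ)

⟦sums⟧ : ∀ {k w n} {B : Subset k} vs uq (vs∈B : All (_∈ B) vs) (B≤w : ∣ B ∣ ≤ w) τ (f : Fin k → Fin n) →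
  ⟦ sums vs uq vs∈B B≤w τ ⟧ f ≡ SumOver vs ⟦ τ ⟧ f
⟦sums⟧ []       _         _            _   τ f = refl
⟦sums⟧ (v ∷ vs) (v∉ ∷ uq) (v∈B ∷ vs∈B) B≤w τ f =
  List.concatMap-cong (λ a → ⟦sums⟧ vs uq vs∈B B≤w τ (f [ v ≔ a ])) (allFin _)

module _ {k m w : ℕ} {bag : Fin (suc m) → Subset k} where

  Family : Set
  Family = ∀ t → Term w (bag t)

  update : Family → ∀ s → Term w (bag s) → Family
  update τ s σ t with t ≟ s
  ... | yes refl = σ
  ... | no _     = τ t

  update-eq : ∀ τ s σ → update τ s σ s ≡ σ
  update-eq τ s σ with s ≟ s
  ... | yes refl = refl
  ... | no s≢s   = contradiction refl s≢s

  update-ne : ∀ τ s σ t → t ≢ s → update τ s σ t ≡ τ t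
  update-ne τ s σ t t≢s with t ≟ s
  ... | yes t≡s = contradiction t≡s t≢s
  ... | no _    = refl

  ∏τ : ∀ {n} → Family → (Fin k → Fin n) → Poly n
  ∏τ τ f = ∏ λ t → ⟦ τ t ⟧ f

  ∏τ-except : ∀ {n} → Family → Fin (suc m) → (Fin k → Fin n) → Poly n
  ∏τ-except τ s f = ∏ (removeAt (λ t → ⟦ τ t ⟧ f) s)

  ∏τ-ext : ∀ {n} (τ : Family) → Extensional {k} {n} (∏τ τ)
  ∏τ-ext {n} τ e = Prod.sum-cong-≗ (*P-commutativeMonoid n) (λ t → ⟦⟧-local (τ t) (λ i _ → e i))

  ∏τ-update : ∀ {n} τ s σ (f : Fin k → Fin n) → ∏τ (update τ s σ) f ≋ ⟦ σ ⟧ f *P ∏τ-except τ s f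
  ∏τ-update τ s σ f = ≋-trans (∏-remove (λ t → ⟦ update τ s σ t ⟧ f) s)
    (*P-cong {p = ⟦ update τ s σ s ⟧ f}
      (≋-reflexive (cong (λ σ → ⟦ σ ⟧ f) (update-eq τ s σ)))
      (∏-cong λ t → ≋-reflexive (cong (λ σ → ⟦ σ ⟧ f) (update-ne τ s σ _ (Fin.punchInᵢ≢i s t)))))

  ∏τ-multiply : ∀ {n} τ s σ (B≤w : ∣ bag s ∣ ≤ w) (f : Fin k → Fin n) →
    ∏τ (update τ s (mul B≤w σ (τ s))) f ≋ ⟦ σ ⟧ f *P ∏τ τ f
  ∏τ-multiply τ s σ B≤w f =
    ≋-trans (∏τ-update τ s (mul B≤w σ (τ s)) f)
      (≋-trans (*P-assoc (⟦ σ ⟧ f) (⟦ τ s ⟧ f) (∏τ-except τ s f))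
        (*P-cong {p = ⟦ σ ⟧ f} ≋-refl (≋-sym (∏-remove (λ t → ⟦ τ t ⟧ f) s))))

module Elimination {k : ℕ} (H : Graph k) (D : TreeDecomposition H) (w : ℕ)
  (∣bag∣≤w : ∀ t → ∣ TreeDecomposition.bag D t ∣ ≤ w) where

  open TreeDecomposition D hiding (width)

  data Descendant (s : Fin (suc m)) : Fin (suc m) → Set where
    self  : Descendant s s
    child : ∀ i → Descendant s (parent i) → Descendant s (suc i)

  descendant-≤ : ∀ {s t} → Descendant s t → toℕ s ≤ toℕ t
  descendant-≤ self        = ℕ.≤-refl
  descendant-≤ (child i d) = ℕ.m≤n⇒m≤1+n (ℕ.≤-trans (descendant-≤ d) (parent< i))

  -- A walk leaves the subtree below suc i only through the edge to parent i.
  stays-below : ∀ {v} i → v ∉ bag (parent i) → ∀ {a b} → Descendant (suc i) a →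
    Walk TAdj (λ t → v ∈ bag t) a b → Descendant (suc i) b
  stays-below i v∉ d here = d
  stays-below i v∉ d (step (j , inj₂ (refl , refl)) v∈ ws) = stays-below i v∉ (child j d) ws
  stays-below i v∉ self (step (.i , inj₁ (refl , refl)) v∈ ws) = contradiction v∈ v∉
  stays-below i v∉ (child j d) (step (.j , inj₁ (refl , refl)) v∈ ws) = stays-below i v∉ d ws

  -- Otherwise a walk from `suc i` to t through bags holding v would stay below `suc i`, where every
  -- index exceeds that of t.
  ∈-parent : ∀ {v} i t → v ∈ bag (suc i) → v ∈ bag t → toℕ t ≤ toℕ i → v ∈ bag (parent i)
  ∈-parent {v} i t v∈s v∈t t≤i with v ∈? bag (parent i)
  ... | yes v∈p = v∈p
  ... | no v∉p  = contradiction
    (descendant-≤ (stays-below i v∉p self (subtree-connected v (suc i) t v∈s v∈t)))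
    (ℕ.<⇒≱ (s≤s t≤i))

  Early : ℕ → Fin k → Set
  Early j v = Σ (Fin (suc m)) λ t → toℕ t ≤ j × v ∈ bag t

  early? : ∀ j → Decidable (Early j)
  early? j v = Fin.any? λ t → (toℕ t ≤? j) ×-dec (v ∈? bag t)

  earlyVertices : ℕ → List (Fin k)
  earlyVertices j = filter (early? j) (allFin k)

  earlyVertices-unique : ∀ j → Unique (earlyVertices j)
  earlyVertices-unique j = Unique.filter⁺ (early? j) (Unique.allFin⁺ k)

  earlyVertices-m : earlyVertices m ≡ allFin k
  earlyVertices-m = List.filter-all (early? m) (All.tabulate (λ {v} _ →
    let t , v∈t = subtree-nonempty v in t , ℕ.≤-pred (Fin.toℕ<n t) , v∈t))

  -- The loop invariant once the bags after j are eliminated. It is uniform in n, so one family of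
  -- terms, hence one cost, serves all n.
  record State (j : ℕ) : Set where
    field
      τ    : ∀ t → Term w (bag t)
      done : ∀ t → j < toℕ t → ∀ {n} (f : Fin k → Fin n) → ⟦ τ t ⟧ f ≡ oneP
      inv  : ∀ {n} (f : Fin k → Fin n) →
             SumOver (allFin k) (edgesP (edgeList H)) f ≋ SumOver (earlyVertices j) (∏τ τ) f

  -- Each edge goes to a single covering bag, since its variable must enter the product once.
  assignEdges : ∀ es → All (λ e → Adj H (proj₁ e) (proj₂ e)) es →
    Σ (∀ t → Term w (bag t)) λ τ → ∀ {n} (f : Fin k → Fin n) → edgesP es f ≋ ∏τ τ f
  assignEdges [] [] = (λ _ → one) , λ f → ≋-sym (∏-ones (suc m) (λ _ → ≋-refl))
  assignEdges ((i , j) ∷ es) (a ∷ as) with assignEdges es as | edge-covered i j a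
  ... | τ , e | t , i∈t , j∈t =
    update τ t (mul (∣bag∣≤w t) (edge i j i∈t j∈t) (τ t)) ,
    λ f → ≋-trans (*P-cong {p = edgeP f i j} ≋-refl (e f))
                  (≋-sym (∏τ-multiply τ t (edge i j i∈t j∈t) (∣bag∣≤w t) f))

  start : State m
  start = record
    { τ    = proj₁ assigned
    ; done = λ t m<t → contradiction m<t (ℕ.≤⇒≯ (ℕ.≤-pred (Fin.toℕ<n t)))
    ; inv  = λ f → subst (λ vs → SumOver (allFin k) (edgesP (edgeList H)) f ≋ SumOver vs (∏τ (proj₁ assigned)) f)
                         (sym earlyVertices-m) (SumOver-cong (allFin k) (proj₂ assigned) f) }
    where assigned = assignEdges (edgeList H) (All.tabulate (∈-edgeList⁻ H))

  module Step (i : Fin m) (S : State (suc (toℕ i))) where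
    open State S

    j = toℕ i
    s = Fin.suc i
    p = parent i

    private-vertices : List (Fin k)
    private-vertices = filter (¬? ∘ early? j) (earlyVertices (suc j))

    earlyVertices-split : earlyVertices (suc j) ↭ earlyVertices j ++ private-vertices
    earlyVertices-split = subst (λ vs → earlyVertices (suc j) ↭ vs ++ private-vertices)
      (filter-filter (early? j) (early? (suc j)) (λ { v (t , t≤j , v∈t) → t , ℕ.m≤n⇒m≤1+n t≤j , v∈t }) (allFin k))
      (filter-split-↭ (early? j) (earlyVertices (suc j)))

    private-¬early : ∀ {v} → v ∈ˡ private-vertices → ¬ Early j v
    private-¬early v∈ = proj₂ (∈-filter⁻ (¬? ∘ early? j) {xs = earlyVertices (suc j)} v∈)

    private-∈s : ∀ {v} → v ∈ˡ private-vertices → v ∈ bag s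
    private-∈s {v} v∈ with ∈-filter⁻ (¬? ∘ early? j) {xs = earlyVertices (suc j)} v∈
    ... | v∈' , ¬e with ∈-filter⁻ (early? (suc j)) {xs = allFin k} v∈'
    ... | _ , t , t≤ , v∈t with ℕ.m≤n⇒m<n∨m≡n t≤
    ...   | inj₁ t<  = contradiction (t , ℕ.≤-pred t< , v∈t) ¬e
    ...   | inj₂ t≡s = subst (λ t → v ∈ bag t) (Fin.toℕ-injective t≡s) v∈t

    private-all : All (_∈ bag s) private-vertices
    private-all = All.tabulate private-∈s

    -- A vertex of s that is not private lies in an earlier bag, and `∈-parent` carries it into the
    -- parent.
    shared⊆p : bag s ∖ private-vertices ⊆ bag p
    shared⊆p {v} v∈ with early? j v
    ... | yes (t , t≤j , v∈t) = ∈-parent i t (∖⊆ (bag s) private-vertices v∈) v∈t t≤j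
    ... | no ¬e = contradiction
      (∈-filter⁺ (¬? ∘ early? j) (∈-filter⁺ (early? (suc j)) (∈-allFin v)
        (s , ℕ.≤-refl , ∖⊆ (bag s) private-vertices v∈)) ¬e)
      (∈-∖⁻ private-vertices v∈)

    message : Term w (bag p)
    message = weaken shared⊆p (sums private-vertices
      (Unique.filter⁺ (¬? ∘ early? j) (earlyVertices-unique (suc j))) private-all (∣bag∣≤w s) (τ s))

    -- Table s is reset to 1 because the message to the parent now accounts for it.
    τ₁ τ₂ : ∀ t → Term w (bag t)
    τ₁ = update τ s one
    τ₂ = update τ₁ p (mul (∣bag∣≤w p) message (τ₁ p))

    -- Tables of later bags are already 1, and no earlier bag contains a private vertex.
    rest-indep : ∀ v → v ∈ˡ private-vertices → ∀ {n} (f : Fin k → Fin n) a →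
      ∏τ-except τ s (f [ v ≔ a ]) ≋ ∏τ-except τ s f
    rest-indep v v∈ f a = ∏-cong λ t → ≋-reflexive (indep (punchIn s t) (Fin.punchInᵢ≢i s t))
      where
      indep : ∀ t → t ≢ s → ⟦ τ t ⟧ (f [ v ≔ a ]) ≡ ⟦ τ t ⟧ f
      indep t t≢s with ℕ.<-cmp (suc j) (toℕ t)
      ... | tri< s<t _ _ = trans (done t s<t (f [ v ≔ a ])) (sym (done t s<t f))
      ... | tri≈ _ s≡t _ = contradiction (Fin.toℕ-injective (sym s≡t)) t≢s
      ... | tri> _ _ t<s = ⟦⟧-local (τ t) λ u u∈t → updateAt-minimal u v f
        λ { refl → private-¬early v∈ (t , ℕ.≤-pred t<s , u∈t) }

    absorb : ∀ {n} (f : Fin k → Fin n) → SumOver private-vertices (∏τ τ) f ≋ ∏τ τ₂ f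
    absorb f =
      ≋-trans (SumOver-cong private-vertices (λ g → ∏-remove (λ t → ⟦ τ t ⟧ g) s) f)
        (≋-trans (SumOver-*ʳ private-vertices (λ v v∈ → rest-indep v v∈) f)
          (≋-trans (*P-cong {p = SumOver private-vertices ⟦ τ s ⟧ f}
                     (≋-reflexive (sym (⟦sums⟧ private-vertices _ private-all (∣bag∣≤w s) (τ s) f)))
                     (≋-trans (≋-sym (*P-identityˡ _)) (≋-sym (∏τ-update τ s one f))))
            (≋-sym (∏τ-multiply τ₁ p message (∣bag∣≤w p) f))))

    next : State j
    next = record
      { τ    = τ₂
      ; done = done₂
      ; inv  = λ f → ≋-trans (inv f)
                 (≋-trans (SumOver-↭ (∏τ-ext τ) earlyVertices-split f)
                   (≋-trans (≋-reflexive (SumOver-++ (earlyVertices j) private-vertices f))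
                     (SumOver-cong (earlyVertices j) absorb f))) }
      where
      done₂ : ∀ t → j < toℕ t → ∀ {n} (f : Fin k → Fin n) → ⟦ τ₂ t ⟧ f ≡ oneP
      done₂ t j<t f = trans (cong (λ σ → ⟦ σ ⟧ f) (update-ne τ₁ p _ t t≢p)) (τ₁-one (t ≟ s))
        where
        t≢p : t ≢ p
        t≢p refl = ℕ.<⇒≱ j<t (parent< i)
        τ₁-one : Dec (t ≡ s) → ⟦ τ₁ t ⟧ f ≡ oneP
        τ₁-one (yes refl) = cong (λ σ → ⟦ σ ⟧ f) (update-eq τ s one)
        τ₁-one (no t≢s)   = trans (cong (λ σ → ⟦ σ ⟧ f) (update-ne τ s one t t≢s))
          (done t (ℕ.≤∧≢⇒< j<t (λ e → t≢s (Fin.toℕ-injective (sym e)))) f)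

  eliminate : ∀ j → j ≤ m → State j → State 0
  eliminate zero    _   S = S
  eliminate (suc j) j<m S = eliminate j (ℕ.<⇒≤ j<m)
    (subst State eq (Step.next (fromℕ< j<m) (subst State (cong suc (sym eq)) S)))
    where
    eq : toℕ (fromℕ< j<m) ≡ j
    eq = Fin.toℕ-fromℕ< j<m

  open State (eliminate m ℕ.≤-refl start)

  early-0 : ∀ {v} → v ∈ˡ earlyVertices 0 → v ∈ bag zero
  early-0 v∈ with ∈-filter⁻ (early? 0) {xs = allFin k} v∈
  ... | _ , zero , _ , v∈0 = v∈0

  early-0-all : All (_∈ bag zero) (earlyVertices 0)
  early-0-all = All.tabulate early-0

  homTerm : Term w (bag zero ∖ earlyVertices 0)
  homTerm = sums (earlyVertices 0) (earlyVertices-unique 0) early-0-all (∣bag∣≤w zero) (τ zero)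

  ⟦homTerm⟧ : ∀ {n} (f : Fin k → Fin n) → ⟦ homTerm ⟧ f ≋ HomPoly H n
  ⟦homTerm⟧ {n} f = ≋-sym
    (≋-trans (HomPoly-≋ H n f)
      (≋-trans (inv f)
        (≋-trans (SumOver-cong (earlyVertices 0) only-root f)
          (≋-reflexive (sym (⟦sums⟧ (earlyVertices 0) _ early-0-all (∣bag∣≤w zero) (τ zero) f))))))
    where
    only-root : ∀ g → ∏τ τ g ≋ ⟦ τ zero ⟧ g
    only-root g = ≋-trans
      (*P-cong {p = ⟦ τ zero ⟧ g} ≋-refl (∏-ones m (λ t → ≋-reflexive (done (suc t) (s≤s z≤n) g))))
      (*P-identityʳ _)

-- The upper bound

≤-foldr-⊔ : ∀ {x} xs → x ∈ˡ xs → x ≤ foldr _⊔_ 0 xs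
≤-foldr-⊔ (y ∷ xs) (here refl) = ℕ.m≤m⊔n y _
≤-foldr-⊔ (y ∷ xs) (there x∈)  = ℕ.≤-trans (≤-foldr-⊔ xs x∈) (ℕ.m≤n⊔m y _)

∣bag∣≤1+width : ∀ {k} {H : Graph k} (D : TreeDecomposition H) t →
  ∣ TreeDecomposition.bag D t ∣ ≤ suc (width D)
∣bag∣≤1+width D t = ℕ.≤-trans (≤-foldr-⊔ _ (∈-map⁺ (λ t → ∣ bag t ∣) (∈-allFin t))) (ℕ.m≤n+m∸n _ 1)
  where open TreeDecomposition D using (bag)

upper-bound : ∀ {k} (H : Graph k) (D : TreeDecomposition H) → Σ ℕ λ c → ∀ n → 1 ≤ n →
  Σ ℕ λ g → Σ (Circuit n (suc g)) λ C →
    Monotone C × Computes C (HomPoly H n) × size C ≤ c * n ^ suc (width D)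
upper-bound {k} H D = cost homTerm + 1 , bound
  where
  open Elimination H D (suc (width D)) (∣bag∣≤1+width D)
  bound : ∀ n → 1 ≤ n → _
  bound n@(suc n-1) _ = _ , C , tt ∷ monotone ext [] , ≋⇒≈P computes , size-bound
    where
    open Table (build {n = n} zero homTerm [])
    f₀ : Fin k → Fin n
    f₀ _ = zero
    -- The output has to be the last gate, so a sum with one wire is put on top; this wire is the
    -- `+ 1` in the constant.
    C = plus (tab f₀ ∷ []) ∷ circuit ext
    computes : output C ≋ HomPoly H n
    computes = ≋-trans (≋-reflexive (List.++-identityʳ _)) (≋-trans (tab-val f₀) (⟦homTerm⟧ f₀))
    W = n ^ suc (width D)
    size-bound : size C ≤ (cost homTerm + 1) * W
    size-bound = begin
      1 + size (circuit ext)     ≤⟨ ℕ.+-mono-≤ (ℕ.m^n>0 n (suc (width D))) (size≤ ext) ⟩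
      W + cost homTerm * W       ≡⟨ cong (λ c → c * W) (ℕ.+-comm 1 (cost homTerm)) ⟩
      (cost homTerm + 1) * W     ∎
      where open ℕ.≤-Reasoning

-- Supports of monotone circuits

at : ∀ {n} → Mono n → Fin n → Fin n → ℕ
at α u v = lookup (lookup α u) v

Pos : ∀ {n} → Mono n → Fin n → Fin n → Set
Pos α u v = 0 < at α u v

at-*M : ∀ {n} (α β : Mono n) u v → at (α *M β) u v ≡ at α u v + at β u v
at-*M α β u v = trans (cong (λ r → lookup r v) (Vec.lookup-zipWith _ u α β))
                      (Vec.lookup-zipWith _+_ v (lookup α u) (lookup β u))

¬Pos-oneM : ∀ {n} (u v : Fin n) → ¬ Pos oneM u v
¬Pos-oneM u v p = ℕ.n≮0
  (subst (0 <_) (trans (cong (λ r → lookup r v) (Vec.lookup-replicate u _)) (Vec.lookup-replicate v 0)) p)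

module _ {n : ℕ} {α β : Mono n} {u v : Fin n} where

  Pos-*M⁻ : Pos (α *M β) u v → Pos α u v ⊎ Pos β u v
  Pos-*M⁻ p with at α u v in eq | subst (0 <_) (at-*M α β u v) p
  ... | suc _ | _ = inj₁ (s≤s z≤n)
  ... | zero  | q = inj₂ q

  Pos-*M⁺ˡ : Pos α u v → Pos (α *M β) u v
  Pos-*M⁺ˡ p = subst (0 <_) (sym (at-*M α β u v)) (ℕ.≤-trans p (ℕ.m≤m+n _ _))

  Pos-*M⁺ʳ : Pos β u v → Pos (α *M β) u v
  Pos-*M⁺ʳ p = subst (0 <_) (sym (at-*M α β u v)) (ℕ.≤-trans p (ℕ.m≤n+m _ _))

at-varM : ∀ {n} (x y u v : Fin n) → at (varM x y) u v ≡
  (if does (u ≟ x) ∧ does (v ≟ y) then 1 else if does (u ≟ y) ∧ does (v ≟ x) then 1 else 0)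
at-varM x y u v = trans (cong (λ r → lookup r v) (Vec.lookup∘tabulate _ u)) (Vec.lookup∘tabulate _ v)

Pos-varM⁻ : ∀ {n} (x y : Fin n) {u v} → Pos (varM x y) u v → (u ≡ x × v ≡ y) ⊎ (u ≡ y × v ≡ x)
Pos-varM⁻ x y {u} {v} p = cases (u ≟ x) (v ≟ y) (u ≟ y) (v ≟ x) (subst (0 <_) (at-varM x y u v) p)
  where
  cases : (a : Dec (u ≡ x)) (b : Dec (v ≡ y)) (c : Dec (u ≡ y)) (d : Dec (v ≡ x)) →
    0 < (if does a ∧ does b then 1 else if does c ∧ does d then 1 else 0) →
    (u ≡ x × v ≡ y) ⊎ (u ≡ y × v ≡ x)
  cases (yes a) (yes b) _       _       _ = inj₁ (a , b)
  cases (yes _) (no _)  (yes c) (yes d) _ = inj₂ (c , d)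
  cases (no _)  _       (yes c) (yes d) _ = inj₂ (c , d)
  cases (yes _) (no _)  (yes _) (no _)  ()
  cases (yes _) (no _)  (no _)  _       ()
  cases (no _)  _       (yes _) (no _)  ()
  cases (no _)  _       (no _)  _       ()

Pos-varM⁺ : ∀ {n} (x y : Fin n) → Pos (varM x y) x y × Pos (varM x y) y x
Pos-varM⁺ x y = subst (0 <_) (sym (at-varM x y x y)) straight , subst (0 <_) (sym (at-varM x y y x)) flipped
  where
  straight : 0 < (if does (x ≟ x) ∧ does (y ≟ y) then 1 else if does (x ≟ y) ∧ does (y ≟ x) then 1 else 0)
  straight rewrite dec-true (x ≟ x) refl | dec-true (y ≟ y) refl = s≤s z≤n
  flipped : 0 < (if does (y ≟ x) ∧ does (x ≟ y) then 1 else if does (y ≟ y) ∧ does (x ≟ x) then 1 else 0)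
  flipped rewrite dec-true (x ≟ x) refl | dec-true (y ≟ y) refl with does (y ≟ x) ∧ does (x ≟ y)
  ... | true  = s≤s z≤n
  ... | false = s≤s z≤n

Pos-varM-sym : ∀ {n} (x y : Fin n) {u v} → Pos (varM x y) u v → Pos (varM x y) v u
Pos-varM-sym x y p with Pos-varM⁻ x y p
... | inj₁ (refl , refl) = proj₂ (Pos-varM⁺ x y)
... | inj₂ (refl , refl) = proj₁ (Pos-varM⁺ x y)

module _ {n : ℕ} {A : Set} (g : A → Mono n) {u v : Fin n} where

  Pos-product⁻ : ∀ es → Pos (foldr _*M_ oneM (map g es)) u v → ∃ λ e → e ∈ˡ es × Pos (g e) u v
  Pos-product⁻ []       p = contradiction p (¬Pos-oneM u v)
  Pos-product⁻ (e ∷ es) p with Pos-*M⁻ {α = g e} p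
  ... | inj₁ q = e , here refl , q
  ... | inj₂ q with Pos-product⁻ es q
  ...   | e' , e'∈ , q' = e' , there e'∈ , q'

  Pos-product⁺ : ∀ es {e} → e ∈ˡ es → Pos (g e) u v → Pos (foldr _*M_ oneM (map g es)) u v
  Pos-product⁺ (e ∷ es) (here refl) p = Pos-*M⁺ˡ {α = g e} p
  Pos-product⁺ (e ∷ es) (there e∈)  p = Pos-*M⁺ʳ {α = g e} (Pos-product⁺ es e∈ p)

module _ {k n : ℕ} (H : Graph k) (ψ : Fin k → Fin n) where

  Pos-homMono⁻ : ∀ {u v} → Pos (homMono H ψ) u v → ∃ λ a → ψ a ≡ u
  Pos-homMono⁻ {u} {v} p
    with Pos-product⁻ _ (edgeList H) (subst (λ μ → Pos μ u v) (homMono-edgeList H ψ) p)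
  ... | (a , b) , e∈ , q with Pos-varM⁻ (ψ a) (ψ b) q
  ... | inj₁ (refl , refl) = a , refl
  ... | inj₂ (refl , refl) = b , refl

  Pos-homMono⁺ : ∀ a b → Adj H a b → Pos (homMono H ψ) (ψ a) (ψ b)
  Pos-homMono⁺ a b ab = subst (λ μ → Pos μ (ψ a) (ψ b)) (sym (homMono-edgeList H ψ)) pos
    where
    pos : Pos (foldr _*M_ oneM (map (λ e → varM (ψ (proj₁ e)) (ψ (proj₂ e))) (edgeList H))) (ψ a) (ψ b)
    pos with Fin.<-cmp a b
    ... | tri< a<b _ _ = Pos-product⁺ _ (edgeList H) (∈-edgeList⁺ H a b ab a<b) (proj₁ (Pos-varM⁺ (ψ a) (ψ b)))
    ... | tri≈ _ refl _ = contradiction (subst T (irrefl H a) ab) (λ ())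
    ... | tri> _ _ b<a = Pos-product⁺ _ (edgeList H)
            (∈-edgeList⁺ H b a (subst T (Graph.sym H a b) ab) b<a) (proj₂ (Pos-varM⁺ (ψ b) (ψ a)))

-- Occurrence is judged before like terms are collected. With nonnegative coefficients nothing
-- cancels, and this is the true support.
Supp : ∀ {n} → Poly n → Mono n → Set
Supp p μ = ∃ λ c → (c , μ) ∈ˡ p × c ≢ 0ℚ

Supp-[-]⁻ : ∀ {n c} {μ ν : Mono n} → Supp ((c , μ) ∷ []) ν → ν ≡ μ
Supp-[-]⁻ (_ , here refl , _) = refl

module _ {n : ℕ} {p q : Poly n} where

  Supp-*P⁻ : ∀ {μ} → Supp (p *P q) μ → ∃ λ α → ∃ λ β → Supp p α × Supp q β × μ ≡ α *M β
  Supp-*P⁻ (c , c∈ , c≢0) with find (∈-concatMap⁻ _ {xs = p} c∈)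
  ... | (a , α) , a∈ , c∈' with ∈-map⁻ _ c∈'
  ... | (b , β) , b∈ , refl =
    α , β , (a , a∈ , λ { refl → c≢0 (ℚ.*-zeroˡ b) }) , (b , b∈ , λ { refl → c≢0 (ℚ.*-zeroʳ a) }) , refl

  Supp-*P⁺ : ∀ {α β} → Supp p α → Supp q β → Supp (p *P q) (α *M β)
  Supp-*P⁺ {α} (a , a∈ , a≢0) (b , b∈ , b≢0) =
    a ℚ.* b , ∈-concatMap⁺ _ (lose a∈ (∈-map⁺ _ b∈)) , x#0y#0→xy#0 ℚ.heytingCommutativeRing a≢0 b≢0

NonNegP : ∀ {n} → Poly n → Set
NonNegP = All λ s → 0ℚ ℚ.≤ proj₁ s

NonNegP-*P : ∀ {n} {p q : Poly n} → NonNegP p → NonNegP q → NonNegP (p *P q)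
NonNegP-*P {p = []}          []        qs = []
NonNegP-*P {p = (a , α) ∷ p} (0≤a ∷ ps) qs =
  All.++⁺ (All.map⁺ (All.map (λ {s} 0≤b → ℚ.nonNegative⁻¹ _
    {{ℚ.nonNeg*nonNeg⇒nonNeg a {{ℚ.nonNegative 0≤a}} (proj₁ s) {{ℚ.nonNegative 0≤b}}}}) qs))
    (NonNegP-*P ps qs)

0≤1ℚ : 0ℚ ℚ.≤ 1ℚ
0≤1ℚ = ℚ.<⇒≤ (ℚ.positive⁻¹ 1ℚ)

gate-NonNegP : ∀ {n g} (gt : Gate n g) (vs : Vec (Poly n) g) → MonotoneGate gt →
  (∀ i → NonNegP (lookup vs i)) → NonNegP (gateVal gt vs)
gate-NonNegP (var u v _) vs m nn = 0≤1ℚ ∷ []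
gate-NonNegP (const c)   vs m nn = m ∷ []
gate-NonNegP (plus is)   vs m nn = go is
  where
  go : ∀ is → NonNegP (foldr _+P_ [] (map (lookup vs) is))
  go []       = []
  go (i ∷ is) = All.++⁺ (nn i) (go is)
gate-NonNegP (times is)  vs m nn = go is
  where
  go : ∀ is → NonNegP (foldr _*P_ oneP (map (lookup vs) is))
  go []       = 0≤1ℚ ∷ []
  go (i ∷ is) = NonNegP-*P (nn i) (go is)

evalAll-NonNegP : ∀ {n g} {C : Circuit n g} → Monotone C → ∀ i → NonNegP (lookup (evalAll C) i)
evalAll-NonNegP {C = gt ∷ C} (m ∷ ms) zero    = gate-NonNegP gt (evalAll C) m (evalAll-NonNegP ms)
evalAll-NonNegP {C = gt ∷ C} (m ∷ ms) (suc i) = evalAll-NonNegP ms i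

coeff≢0⇒Supp : ∀ {n} (p : Poly n) {μ} → coeff p μ ≢ 0ℚ → Supp p μ
coeff≢0⇒Supp []            ne = contradiction refl ne
coeff≢0⇒Supp ((c , ν) ∷ p) {μ} ne with ν ≟M μ
... | no _ = let c' , c'∈ , c'≢0 = coeff≢0⇒Supp p ne in c' , there c'∈ , c'≢0
... | yes refl with c ℚ.≟ 0ℚ
...   | no c≢0   = c , here refl , c≢0
...   | yes refl = let c' , c'∈ , c'≢0 = coeff≢0⇒Supp p (λ e → ne (trans (ℚ.+-identityˡ _) e))
                   in c' , there c'∈ , c'≢0

coeff-nonNeg : ∀ {n} {p : Poly n} μ → NonNegP p → 0ℚ ℚ.≤ coeff p μ
coeff-nonNeg {p = []} μ [] = ℚ.≤-refl
coeff-nonNeg {p = (c , ν) ∷ p} μ (0≤c ∷ nn) with does (ν ≟M μ)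
... | false = coeff-nonNeg μ nn
... | true  = ℚ.+-mono-≤ 0≤c (coeff-nonNeg μ nn)

-- This is where monotonicity enters: no term can cancel a positive one.
Supp⇒coeff≢0 : ∀ {n} {p : Poly n} {μ} → NonNegP p → Supp p μ → coeff p μ ≢ 0ℚ
Supp⇒coeff≢0 nn s = ℚ.<⇒≢ (positive nn s) ∘ sym
  where
  positive : ∀ {p μ} → NonNegP p → Supp p μ → 0ℚ ℚ.< coeff p μ
  positive {(c , ν) ∷ p} {μ} (0≤c ∷ nn) (_ , here refl , c≢0) rewrite dec-true (ν ≟M ν) refl =
    ℚ.+-mono-<-≤ (ℚ.≰⇒> λ c≤0 → c≢0 (ℚ.≤-antisym c≤0 0≤c)) (coeff-nonNeg μ nn)
  positive {(c , ν) ∷ p} {μ} (0≤c ∷ nn) (d , there d∈ , d≢0) with does (ν ≟M μ)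
  ... | false = positive nn (d , d∈ , d≢0)
  ... | true  = ℚ.+-mono-≤-< 0≤c (positive nn (d , d∈ , d≢0))

-- Tree decompositions from parse trees

majority : ∀ {k} → Subset k → Subset k → Subset k → Subset k
majority a b c = (a ∩ b) ∪ ((a ∩ c) ∪ (b ∩ c))

module _ {k : ℕ} {a b c : Subset k} {v : Fin k} where

  majority⁻ : v ∈ majority a b c → (v ∈ a × v ∈ b) ⊎ (v ∈ a × v ∈ c) ⊎ (v ∈ b × v ∈ c)
  majority⁻ h with x∈p∪q⁻ (a ∩ b) _ h
  ... | inj₁ h₁ = inj₁ (x∈p∩q⁻ a b h₁)
  ... | inj₂ h₂ with x∈p∪q⁻ (a ∩ c) (b ∩ c) h₂
  ...   | inj₁ h₃ = inj₂ (inj₁ (x∈p∩q⁻ a c h₃))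
  ...   | inj₂ h₃ = inj₂ (inj₂ (x∈p∩q⁻ b c h₃))

  majority⁺₁₂ : v ∈ a → v ∈ b → v ∈ majority a b c
  majority⁺₁₂ x y = x∈p∪q⁺ (inj₁ (x∈p∩q⁺ (x , y)))

  majority⁺₁₃ : v ∈ a → v ∈ c → v ∈ majority a b c
  majority⁺₁₃ x y = x∈p∪q⁺ (inj₂ (x∈p∪q⁺ (inj₁ (x∈p∩q⁺ (x , y)))))

  majority⁺₂₃ : v ∈ b → v ∈ c → v ∈ majority a b c
  majority⁺₂₃ x y = x∈p∪q⁺ (inj₂ (x∈p∪q⁺ (inj₂ (x∈p∩q⁺ (x , y)))))

walk-++ : ∀ {A : Set} {R : A → A → Set} {P : A → Set} {a b c} → Walk R P a b → Walk R P b c → Walk R P a c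
walk-++ here         ws = ws
walk-++ (step r p v) ws = step r p (walk-++ v ws)

walk-map : ∀ {A B : Set} {R : A → A → Set} {S : B → B → Set} {P : A → Set} {Q : B → Set} (h : A → B) →
  (∀ {a b} → R a b → S (h a) (h b)) → (∀ {a} → P a → Q (h a)) → ∀ {a b} → Walk R P a b → Walk S Q (h a) (h b)
walk-map h f g here         = here
walk-map h f g (step r p v) = step (f r) (g p) (walk-map h f g v)

record BagTree (k : ℕ) : Set where
  field
    {m}     : ℕ
    parent  : Fin m → Fin (suc m)
    parent≤ : ∀ i → toℕ (parent i) ≤ toℕ i
    bag     : Fin (suc m) → Subset k

  TAdj : Fin (suc m) → Fin (suc m) → Set
  TAdj a b = Σ (Fin m) λ i → (a ≡ suc i × b ≡ parent i) ⊎ (b ≡ suc i × a ≡ parent i)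

-- The root comes first, then the nodes of S, then those of T; in this order parents keep smaller
-- indices.
module Join {k : ℕ} (X : Subset k) (S T : BagTree k) where
  private
    module S = BagTree S
    module T = BagTree T

  N = suc S.m + suc T.m

  left : Fin (suc S.m) → Fin (suc N)
  left a = suc (a ↑ˡ suc T.m)

  right : Fin (suc T.m) → Fin (suc N)
  right b = suc (suc S.m ↑ʳ b)

  parent′ : Fin (suc S.m) ⊎ Fin (suc T.m) → Fin (suc N)
  parent′ (inj₁ zero)    = zero
  parent′ (inj₁ (suc i)) = left (S.parent i)
  parent′ (inj₂ zero)    = zero
  parent′ (inj₂ (suc i)) = right (T.parent i)

  parent≤′ : ∀ x → toℕ (parent′ x) ≤ toℕ (join (suc S.m) (suc T.m) x)
  parent≤′ (inj₁ zero)    = z≤n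
  parent≤′ (inj₁ (suc i)) = s≤s (subst₂ _≤_ (sym (Fin.toℕ-↑ˡ (S.parent i) _)) (sym (Fin.toℕ-↑ˡ i _)) (S.parent≤ i))
  parent≤′ (inj₂ zero)    = z≤n
  parent≤′ (inj₂ (suc i)) = subst₂ _≤_ (cong suc (sym (Fin.toℕ-↑ʳ (suc S.m) (T.parent i)))) eq
    (s≤s (ℕ.+-monoʳ-≤ (suc S.m) (T.parent≤ i)))
    where
    eq : suc (suc S.m + toℕ i) ≡ toℕ (suc S.m ↑ʳ suc i)
    eq = trans (sym (ℕ.+-suc (suc S.m) (toℕ i))) (sym (Fin.toℕ-↑ʳ (suc S.m) (suc i)))

  joined : BagTree k
  joined = record
    { parent  = parent′ ∘ splitAt (suc S.m)
    ; parent≤ = λ i → subst (λ j → toℕ (parent′ (splitAt (suc S.m) i)) ≤ toℕ j)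
                        (Fin.join-splitAt (suc S.m) (suc T.m) i) (parent≤′ (splitAt (suc S.m) i))
    ; bag     = λ { zero → X ; (suc i) → [ S.bag , T.bag ]′ (splitAt (suc S.m) i) } }

  open BagTree joined

  data View : Fin (suc N) → Set where
    at-root  : View zero
    at-left  : ∀ a → View (left a)
    at-right : ∀ b → View (right b)

  view : ∀ t → View t
  view zero = at-root
  view (suc i) with splitAt (suc S.m) i in eq
  ... | inj₁ a = subst (View ∘ suc) (Fin.splitAt⁻¹-↑ˡ eq) (at-left a)
  ... | inj₂ b = subst (View ∘ suc) (Fin.splitAt⁻¹-↑ʳ eq) (at-right b)

  bag-left : ∀ a → bag (left a) ≡ S.bag a
  bag-left a = cong [ S.bag , T.bag ]′ (Fin.splitAt-↑ˡ (suc S.m) a (suc T.m))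

  bag-right : ∀ b → bag (right b) ≡ T.bag b
  bag-right b = cong [ S.bag , T.bag ]′ (Fin.splitAt-↑ʳ (suc S.m) (suc T.m) b)

  parent-left : ∀ a → parent (a ↑ˡ suc T.m) ≡ parent′ (inj₁ a)
  parent-left a = cong parent′ (Fin.splitAt-↑ˡ (suc S.m) a (suc T.m))

  parent-right : ∀ b → parent (suc S.m ↑ʳ b) ≡ parent′ (inj₂ b)
  parent-right b = cong parent′ (Fin.splitAt-↑ʳ (suc S.m) (suc T.m) b)

  TAdj-left : ∀ {a b} → S.TAdj a b → TAdj (left a) (left b)
  TAdj-left (i , inj₁ (refl , refl)) = _ , inj₁ (refl , sym (parent-left (suc i)))
  TAdj-left (i , inj₂ (refl , refl)) = _ , inj₂ (refl , sym (parent-left (suc i)))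

  TAdj-right : ∀ {a b} → T.TAdj a b → TAdj (right a) (right b)
  TAdj-right (i , inj₁ (refl , refl)) = _ , inj₁ (refl , sym (parent-right (suc i)))
  TAdj-right (i , inj₂ (refl , refl)) = _ , inj₂ (refl , sym (parent-right (suc i)))

  module _ (v : Fin k) where

    Path : ∀ (a b : Fin (suc N)) → Set
    Path = Walk TAdj (λ t → v ∈ bag t)

    ∈-left : ∀ {a} → v ∈ S.bag a → v ∈ bag (left a)
    ∈-left {a} = subst (v ∈_) (sym (bag-left a))

    ∈-right : ∀ {b} → v ∈ T.bag b → v ∈ bag (right b)
    ∈-right {b} = subst (v ∈_) (sym (bag-right b))

    module _ (connS : ∀ a b → v ∈ S.bag a → v ∈ S.bag b → Walk S.TAdj (λ t → v ∈ S.bag t) a b)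
             (connT : ∀ a b → v ∈ T.bag a → v ∈ T.bag b → Walk T.TAdj (λ t → v ∈ T.bag t) a b)
             (rootS : ∀ a → v ∈ S.bag a → v ∈ X → v ∈ S.bag zero)
             (rootT : ∀ b → v ∈ T.bag b → v ∈ X → v ∈ T.bag zero)
             (both  : ∀ a b → v ∈ S.bag a → v ∈ T.bag b → v ∈ X) where

      up-left : ∀ a → v ∈ S.bag a → v ∈ X → Path (left a) zero
      up-left a v∈a v∈X = walk-++ (walk-map left TAdj-left ∈-left (connS a zero v∈a (rootS a v∈a v∈X)))
        (step (_ , inj₁ (refl , sym (parent-left zero))) v∈X here)

      up-right : ∀ b → v ∈ T.bag b → v ∈ X → Path (right b) zero
      up-right b v∈b v∈X = walk-++ (walk-map right TAdj-right ∈-right (connT b zero v∈b (rootT b v∈b v∈X)))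
        (step (_ , inj₁ (refl , sym (parent-right zero))) v∈X here)

      down-left : ∀ a → v ∈ S.bag a → v ∈ X → Path zero (left a)
      down-left a v∈a v∈X = step (_ , inj₂ (refl , sym (parent-left zero))) (∈-left (rootS a v∈a v∈X))
        (walk-map left TAdj-left ∈-left (connS zero a (rootS a v∈a v∈X) v∈a))

      down-right : ∀ b → v ∈ T.bag b → v ∈ X → Path zero (right b)
      down-right b v∈b v∈X = step (_ , inj₂ (refl , sym (parent-right zero))) (∈-right (rootT b v∈b v∈X))
        (walk-map right TAdj-right ∈-right (connT zero b (rootT b v∈b v∈X) v∈b))

      -- A walk between the halves goes through the new root, which holds v by `both`; `rootS` and
      -- `rootT` let it continue into each half.
      joined-connected : ∀ a b → v ∈ bag a → v ∈ bag b → Path a b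
      joined-connected s t v∈s v∈t with view s | view t
      ... | at-root    | at-root    = here
      ... | at-root    | at-left b  = down-left b (subst (v ∈_) (bag-left b) v∈t) v∈s
      ... | at-root    | at-right b = down-right b (subst (v ∈_) (bag-right b) v∈t) v∈s
      ... | at-left a  | at-root    = up-left a (subst (v ∈_) (bag-left a) v∈s) v∈t
      ... | at-right a | at-root    = up-right a (subst (v ∈_) (bag-right a) v∈s) v∈t
      ... | at-left a  | at-left b  = walk-map left TAdj-left ∈-left
        (connS a b (subst (v ∈_) (bag-left a) v∈s) (subst (v ∈_) (bag-left b) v∈t))
      ... | at-right a | at-right b = walk-map right TAdj-right ∈-right
        (connT a b (subst (v ∈_) (bag-right a) v∈s) (subst (v ∈_) (bag-right b) v∈t))
      ... | at-left a  | at-right b = walk-++ (up-left a v∈a (both a b v∈a v∈b)) (down-right b v∈b (both a b v∈a v∈b))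
        where
        v∈a = subst (v ∈_) (bag-left a) v∈s
        v∈b = subst (v ∈_) (bag-right b) v∈t
      ... | at-right b | at-left a  = walk-++ (up-right b v∈b (both a b v∈a v∈b)) (down-left a v∈a (both a b v∈a v∈b))
        where
        v∈a = subst (v ∈_) (bag-left a) v∈t
        v∈b = subst (v ∈_) (bag-right b) v∈s

-- A partial tree decomposition covering the edges E on the vertices A, whose
-- root bag contains every vertex of A also lying on an edge outside E (i.e. in O).
record Fragment {k} (A O : Subset k) (E : Fin k → Fin k → Set) (Good : Subset k → Set) : Set where
  field
    tree      : BagTree k
  open BagTree tree public
  field
    covers    : ∀ i j → E i j → Σ (Fin (suc m)) λ t → i ∈ bag t × j ∈ bag t
    bag⊆      : ∀ t {v} → v ∈ bag t → v ∈ A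
    interface : ∀ {v} → v ∈ A → v ∈ O → v ∈ bag zero
    connected : ∀ v a b → v ∈ bag a → v ∈ bag b → Walk TAdj (λ t → v ∈ bag t) a b
    good      : ∀ t → Good (bag t)

leaf : ∀ {k} {A O : Subset k} {E Good} → (∀ i j → E i j → i ∈ A × j ∈ A) → Good A → Fragment A O E Good
leaf {A = A} cov gd = record
  { tree      = record { m = 0 ; parent = λ () ; parent≤ = λ () ; bag = λ _ → A }
  ; covers    = λ i j e → zero , cov i j e
  ; bag⊆      = λ _ h → h
  ; interface = λ h _ → h
  ; connected = λ { v zero zero _ _ → here }
  ; good      = λ _ → gd }

-- Seen from A, the outside is B together with O, and symmetrically for B. So a vertex of A in the
-- new root lies on the interface of the first fragment and hence in its root bag, as connectedness
-- demands.
node : ∀ {k} {A B O A∪B O₁ O₂ : Subset k} {E₁ E₂ E Good} →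
  (∀ {v} → v ∈ A∪B → v ∈ A ⊎ v ∈ B) → (∀ {v} → v ∈ A ⊎ v ∈ B → v ∈ A∪B) →
  (∀ {v} → v ∈ B ⊎ v ∈ O → v ∈ O₁) → (∀ {v} → v ∈ A ⊎ v ∈ O → v ∈ O₂) →
  (∀ {i j} → E i j → E₁ i j ⊎ E₂ i j) → Good (majority A B O) →
  Fragment A O₁ E₁ Good → Fragment B O₂ E₂ Good → Fragment A∪B O E Good
node {k} {A} {B} {O} {A∪B} {E = E} {Good} split union out₁ out₂ splitE gd F₁ F₂ = record
  { tree      = joined
  ; covers    = λ i j e → cover (splitE e)
  ; bag⊆      = contained
  ; interface = λ v∈A∪B v∈O → [ (λ v∈A → majority⁺₁₃ v∈A v∈O) , (λ v∈B → majority⁺₂₃ v∈B v∈O) ]′ (split v∈A∪B)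
  ; connected = λ v → joined-connected v (F₁.connected v) (F₂.connected v) (root₁ v) (root₂ v)
                  (λ a b v∈a v∈b → majority⁺₁₂ (F₁.bag⊆ a v∈a) (F₂.bag⊆ b v∈b))
  ; good      = allGood }
  where
  module F₁ = Fragment F₁
  module F₂ = Fragment F₂
  X = majority A B O
  open Join X F₁.tree F₂.tree
  open BagTree joined

  cover : ∀ {i j} → _ ⊎ _ → Σ (Fin (suc m)) λ t → i ∈ bag t × j ∈ bag t
  cover {i} {j} (inj₁ e) = let t , i∈ , j∈ = F₁.covers i j e in left t , ∈-left i i∈ , ∈-left j j∈
  cover {i} {j} (inj₂ e) = let t , i∈ , j∈ = F₂.covers i j e in right t , ∈-right i i∈ , ∈-right j j∈

  contained : ∀ t {v} → v ∈ bag t → v ∈ A∪B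
  contained t {v} v∈ with view t
  ... | at-left a  = union (inj₁ (F₁.bag⊆ a (subst (v ∈_) (bag-left a) v∈)))
  ... | at-right b = union (inj₂ (F₂.bag⊆ b (subst (v ∈_) (bag-right b) v∈)))
  ... | at-root with majority⁻ {a = A} {B} {O} v∈
  ...   | inj₁ (v∈A , _)        = union (inj₁ v∈A)
  ...   | inj₂ (inj₁ (v∈A , _)) = union (inj₁ v∈A)
  ...   | inj₂ (inj₂ (v∈B , _)) = union (inj₂ v∈B)

  root₁ : ∀ v a → v ∈ F₁.bag a → v ∈ X → v ∈ F₁.bag zero
  root₁ v a v∈a v∈X = F₁.interface (F₁.bag⊆ a v∈a) (out₁ (cases (majority⁻ {a = A} {B} {O} v∈X)))
    where
    cases : (v ∈ A × v ∈ B) ⊎ (v ∈ A × v ∈ O) ⊎ (v ∈ B × v ∈ O) → v ∈ B ⊎ v ∈ O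
    cases (inj₁ (_ , b))        = inj₁ b
    cases (inj₂ (inj₁ (_ , o))) = inj₂ o
    cases (inj₂ (inj₂ (b , _))) = inj₁ b

  root₂ : ∀ v b → v ∈ F₂.bag b → v ∈ X → v ∈ F₂.bag zero
  root₂ v b v∈b v∈X = F₂.interface (F₂.bag⊆ b v∈b) (out₂ (cases (majority⁻ {a = A} {B} {O} v∈X)))
    where
    cases : (v ∈ A × v ∈ B) ⊎ (v ∈ A × v ∈ O) ⊎ (v ∈ B × v ∈ O) → v ∈ A ⊎ v ∈ O
    cases (inj₁ (a , _))        = inj₁ a
    cases (inj₂ (inj₁ (a , _))) = inj₁ a
    cases (inj₂ (inj₂ (_ , o))) = inj₂ o

  allGood : ∀ t → Good (bag t)
  allGood t with view t
  ... | at-root    = gd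
  ... | at-left a  = subst Good (sym (bag-left a)) (F₁.good a)
  ... | at-right b = subst Good (sym (bag-right b)) (F₂.good b)

-- A fragment promises to cover edges only; a vertex gets into a bag through an edge to a neighbour.
toTreeDecomposition : ∀ {k} {H : Graph k} {A O : Subset k} {E Good} → Fragment A O E Good →
  (∀ {i j} → Adj H i j → E i j) → (∀ v → ∃ λ u → Adj H v u) → TreeDecomposition H
toTreeDecomposition F cov nbr = record
  { m                 = m
  ; parent            = parent
  ; parent<           = parent≤
  ; bag               = bag
  ; edge-covered      = λ i j a → covers i j (cov a)
  ; subtree-nonempty  = λ v → let u , a = nbr v ; t , v∈t , _ = covers v u (cov a) in t , v∈t
  ; subtree-connected = connected }
  where open Fragment F

-- Vertex sets of monomials and the exchange argument

posRow? : ∀ {n} (α : Mono n) u → Dec (∃ λ v → Pos α u v)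
posRow? α u = Fin.any? λ v → 0 <? at α u v

-- The endpoints of the variables that divide α, read back in H along φ.
V : ∀ {k n} → (Fin k → Fin n) → Mono n → Subset k
V φ α = tabulate λ i → does (posRow? α (φ i))

module _ {k n : ℕ} (φ : Fin k → Fin n) where

  ∈V⁺ : ∀ {α i v} → Pos α (φ i) v → i ∈ V φ α
  ∈V⁺ {α} {i} {v} p = Vec.lookup⇒[]= i _ (trans (Vec.lookup∘tabulate _ i) (dec-true (posRow? α (φ i)) (v , p)))

  ∈V⁻ : ∀ {α i} → i ∈ V φ α → ∃ λ v → Pos α (φ i) v
  ∈V⁻ {α} {i} h with posRow? α (φ i) | trans (sym (Vec.lookup∘tabulate _ i)) (Vec.[]=⇒lookup h)
  ... | yes p | _ = p

  V-*M⁻ : ∀ {α β i} → i ∈ V φ (α *M β) → i ∈ V φ α ⊎ i ∈ V φ β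
  V-*M⁻ {α} {β} h with ∈V⁻ {α *M β} h
  ... | v , p with Pos-*M⁻ {α = α} {β} p
  ...   | inj₁ q = inj₁ (∈V⁺ {α} q)
  ...   | inj₂ q = inj₂ (∈V⁺ {β} q)

  V-*M⁺ : ∀ {α β i} → i ∈ V φ α ⊎ i ∈ V φ β → i ∈ V φ (α *M β)
  V-*M⁺ {α} {β} (inj₁ h) = let v , p = ∈V⁻ {α} h in ∈V⁺ {α *M β} (Pos-*M⁺ˡ {α = α} {β} p)
  V-*M⁺ {α} {β} (inj₂ h) = let v , p = ∈V⁻ {β} h in ∈V⁺ {α *M β} (Pos-*M⁺ʳ {α = α} {β} p)

  V-oneM : ∀ {i} → ¬ (i ∈ V φ oneM)
  V-oneM {i} h = let v , p = ∈V⁻ {oneM} h in ¬Pos-oneM (φ i) v p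

-- Pigeonhole: s is injective, and if it missed a, then punching out a would inject a set of `suc k`
-- elements into one of k.
section-surjective : ∀ {k} {σ s : Fin k → Fin k} → (∀ i → σ (s i) ≡ i) → ∀ a → s (σ a) ≡ a
section-surjective {suc k} {σ} {s} sec a with Fin.any? (λ i → s i ≟ a)
... | yes (i , refl) = cong s (sec i)
... | no ¬hit = contradiction (Fin.injective⇒≤ avoid-injective) ℕ.1+n≰n
  where
  s≢a : ∀ i → a ≢ s i
  s≢a i e = ¬hit (i , sym e)
  avoid-injective : ∀ {i j} → punchOut (s≢a i) ≡ punchOut (s≢a j) → i ≡ j
  avoid-injective {i} {j} e =
    trans (sym (sec i)) (trans (cong σ (Fin.punchOut-injective (s≢a i) (s≢a j) e)) (sec j))

surjective⇒injective : ∀ {k} (σ : Fin k → Fin k) → (∀ i → ∃ λ a → σ a ≡ i) → ∀ {a b} → σ a ≡ σ b → a ≡ b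
surjective⇒injective σ surj {a} {b} e =
  trans (sym (retract a)) (trans (cong (proj₁ ∘ surj) e) (retract b))
  where retract = section-surjective {σ = σ} {proj₁ ∘ surj} (proj₂ ∘ surj)

-- The tag keeps leaves apart from products, for which agreement on the bag has different reasons.
data Kind : Set where
  isProduct isVariable : Kind

-- What is remembered of a factorisation besides its wire. It mentions subsets of [k] only, so the
-- number of labels does not grow with n.
record Label (k : ℕ) : Set where
  constructor label
  field
    kind        : Kind
    in₁ in₂ out : Subset k

bagOf : ∀ {k} → Label k → Subset k
bagOf (label isProduct  a b o) = majority a b o
bagOf (label isVariable a _ _) = a

-- Each wire is recorded as a pair (P , R): P is the value of the child, and R the product of
-- the children after it (1 at a sum gate).
timesItems : ∀ {n g} → Vec (Poly n) g → List (Fin g) → List (Poly n × Poly n)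
timesItems vs []       = []
timesItems vs (i ∷ is) = (lookup vs i , foldr _*P_ oneP (map (lookup vs) is)) ∷ timesItems vs is

gateItems : ∀ {n g} → Gate n g → Vec (Poly n) g → List (Poly n × Poly n)
gateItems (var _ _ _) vs = []
gateItems (const _)   vs = []
gateItems (plus is)   vs = map (λ i → lookup vs i , oneP) is
gateItems (times is)  vs = timesItems vs is

items : ∀ {n g} → Circuit n g → List (Poly n × Poly n)
items []       = []
items (gt ∷ C) = gateItems gt (evalAll C) ++ items C

length-timesItems : ∀ {n g} (vs : Vec (Poly n) g) is → length (timesItems vs is) ≡ length is
length-timesItems vs []       = refl
length-timesItems vs (i ∷ is) = cong suc (length-timesItems vs is)

length-gateItems : ∀ {n g} (gt : Gate n g) vs → length (gateItems gt vs) ≡ fanIn gt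
length-gateItems (var _ _ _) vs = refl
length-gateItems (const _)   vs = refl
length-gateItems (plus is)   vs = List.length-map _ is
length-gateItems (times is)  vs = length-timesItems vs is

length-items : ∀ {n g} (C : Circuit n g) → length (items C) ≡ size C
length-items []       = refl
length-items (gt ∷ C) = trans (List.length-++ (gateItems gt (evalAll C)))
  (cong₂ _+_ (length-gateItems gt (evalAll C)) (length-items C))

module _ {k n : ℕ} (H : Graph k) (nbr : ∀ (v : Fin k) → ∃ λ (u : Fin k) → Adj H v u)
  (col : Fin n → Fin k) where

  HomMonomial : Mono n → Set
  HomMonomial μ = ∃ λ (ψ : Fin k → Fin n) → homMono H ψ ≡ μ

  Coloured : (Fin k → Fin n) → Set
  Coloured φ = ∀ i → col (φ i) ≡ i

  V-homMono : ∀ (φ : Fin k → Fin n) i → i ∈ V φ (homMono H φ)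
  V-homMono φ i = let j , a = nbr i in ∈V⁺ φ {homMono H φ} (Pos-homMono⁺ H φ i j a)

  -- If αβ is the monomial of ψ then col ∘ ψ is onto, hence one-to-one, so the preimages under ψ
  -- of φ i (from α) and of φ' i (from β), which have the same colour, coincide.
  exchange : ∀ {φ φ'} → Coloured φ → Coloured φ' → ∀ {α β} → HomMonomial (α *M β) →
    (∀ j → j ∈ V φ α ⊎ j ∈ V φ' β) → ∀ {i} → i ∈ V φ α → i ∈ V φ' β → φ i ≡ φ' i
  exchange {φ} {φ'} cφ cφ' {α} {β} (ψ , eq) total {i} i∈α i∈β =
    trans (sym (proj₂ (hitα i∈α))) (trans (cong ψ a≡b) (proj₂ (hitβ i∈β)))
    where
    hitα : ∀ {j} → j ∈ V φ α → ∃ λ a → ψ a ≡ φ j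
    hitα {j} h = let v , p = ∈V⁻ φ {α} h in
      Pos-homMono⁻ H ψ {v = v} (subst (λ μ → Pos μ (φ j) v) (sym eq) (Pos-*M⁺ˡ {α = α} {β} p))
    hitβ : ∀ {j} → j ∈ V φ' β → ∃ λ a → ψ a ≡ φ' j
    hitβ {j} h = let v , p = ∈V⁻ φ' {β} h in
      Pos-homMono⁻ H ψ {v = v} (subst (λ μ → Pos μ (φ' j) v) (sym eq) (Pos-*M⁺ʳ {α = α} {β} p))
    onto : ∀ j → ∃ λ a → col (ψ a) ≡ j
    onto j with total j
    ... | inj₁ h = let a , e = hitα h in a , trans (cong col e) (cφ j)
    ... | inj₂ h = let a , e = hitβ h in a , trans (cong col e) (cφ' j)
    a≡b : proj₁ (hitα i∈α) ≡ proj₁ (hitβ i∈β)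
    a≡b = surjective⇒injective (col ∘ ψ) onto
      (trans (trans (cong col (proj₂ (hitα i∈α))) (cφ i)) (sym (trans (cong col (proj₂ (hitβ i∈β))) (cφ' i))))

  -- The context condition says that q completes every monomial of P * R to a monomial of Hom,
  -- so that monomials of different homomorphisms can be exchanged at the wire (P , R).
  data Witness (φ : Fin k → Fin n) : Poly n × Poly n → Label k → Set where
    split : ∀ {P R} α ρ q → Supp P α → Supp R ρ →
      (∀ {α' ρ'} → Supp P α' → Supp R ρ' → HomMonomial ((α' *M ρ') *M q)) →
      (α *M ρ) *M q ≡ homMono H φ → Witness φ (P , R) (label isProduct (V φ α) (V φ ρ) (V φ q))
    single : ∀ {P R} α q → Supp P α → (∀ {α'} → Supp P α' → α' ≡ α) →
      α *M q ≡ homMono H φ → Witness φ (P , R) (label isVariable (V φ α) ⊥ ⊥)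

  module _ {φ φ' : Fin k → Fin n} (cφ : Coloured φ) (cφ' : Coloured φ') where

    -- Two exchanges suffice. Putting α in place of α' settles the vertices that α shares with ρ or
    -- q, and putting ρ in place of ρ' those that ρ shares with q. The equal vertex sets ensure that
    -- each mixture meets every colour.
    agree-split : ∀ {α ρ q α' ρ' q'} →
      HomMonomial ((α *M ρ') *M q') → HomMonomial ((α' *M ρ) *M q') → (α *M ρ) *M q ≡ homMono H φ →
      V φ α ≡ V φ' α' → V φ ρ ≡ V φ' ρ' → V φ q ≡ V φ' q' →
      ∀ {i} → i ∈ majority (V φ α) (V φ ρ) (V φ q) → φ i ≡ φ' i
    agree-split {α} {ρ} {q} {α'} {ρ'} {q'} hα hρ eq eα eρ eq' {i} i∈ =
      cases (majority⁻ {a = V φ α} {V φ ρ} {V φ q} i∈)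
      where
      in-three : ∀ j → j ∈ V φ α ⊎ j ∈ V φ ρ ⊎ j ∈ V φ q
      in-three j with V-*M⁻ φ {α *M ρ} {q} (subst (λ μ → j ∈ V φ μ) (sym eq) (V-homMono φ j))
      ... | inj₂ h = inj₂ (inj₂ h)
      ... | inj₁ h with V-*M⁻ φ {α} {ρ} h
      ...   | inj₁ h' = inj₁ h'
      ...   | inj₂ h' = inj₂ (inj₁ h')

      ρ'q' : ∀ {j} → j ∈ V φ ρ ⊎ j ∈ V φ q → j ∈ V φ' (ρ' *M q')
      ρ'q' {j} = V-*M⁺ φ' {ρ'} {q'} ∘ [ inj₁ ∘ subst (j ∈_) eρ , inj₂ ∘ subst (j ∈_) eq' ]′

      α'q' : ∀ {j} → j ∈ V φ α ⊎ j ∈ V φ q → j ∈ V φ' (α' *M q')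
      α'q' {j} = V-*M⁺ φ' {α'} {q'} ∘ [ inj₁ ∘ subst (j ∈_) eα , inj₂ ∘ subst (j ∈_) eq' ]′

      via-α : ∀ {i} → i ∈ V φ α → i ∈ V φ ρ ⊎ i ∈ V φ q → φ i ≡ φ' i
      via-α i∈α i∈ρq = exchange cφ cφ' {α} {ρ' *M q'} (subst HomMonomial (*M-assoc α ρ' q') hα)
        (λ j → [ inj₁ , inj₂ ∘ ρ'q' ]′ (in-three j)) i∈α (ρ'q' i∈ρq)

      total-ρ : ∀ j → j ∈ V φ ρ ⊎ j ∈ V φ' (α' *M q')
      total-ρ j with in-three j
      ... | inj₁ h        = inj₂ (α'q' (inj₁ h))
      ... | inj₂ (inj₁ h) = inj₁ h
      ... | inj₂ (inj₂ h) = inj₂ (α'q' (inj₂ h))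

      via-ρ : ∀ {i} → i ∈ V φ ρ → i ∈ V φ q → φ i ≡ φ' i
      via-ρ i∈ρ i∈q = exchange cφ cφ' {ρ} {α' *M q'}
        (subst HomMonomial (trans (cong (_*M q') (*M-comm α' ρ)) (*M-assoc ρ α' q')) hρ)
        total-ρ i∈ρ (α'q' (inj₂ i∈q))

      cases : (i ∈ V φ α × i ∈ V φ ρ) ⊎ (i ∈ V φ α × i ∈ V φ q) ⊎ (i ∈ V φ ρ × i ∈ V φ q) → φ i ≡ φ' i
      cases (inj₁ (a , r))        = via-α a (inj₁ r)
      cases (inj₂ (inj₁ (a , o))) = via-α a (inj₂ o)
      cases (inj₂ (inj₂ (r , o))) = via-ρ r o

    -- At a leaf both maps carry the same monomial α, so φ i is also a value of φ', and its colour
    -- tells at which vertex.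
    agree-single : ∀ {α q'} → α *M q' ≡ homMono H φ' → ∀ {i} → i ∈ V φ α → φ i ≡ φ' i
    agree-single {α} {q'} eq {i} i∈ =
      let v , p = ∈V⁻ φ {α} i∈
          j , e = Pos-homMono⁻ H φ' {v = v} (subst (λ μ → Pos μ (φ i) v) eq (Pos-*M⁺ˡ {α = α} {q'} p))
          j≡i   = trans (sym (cφ' j)) (trans (cong col e) (cφ i))
      in trans (sym e) (cong φ' j≡i)

    agree : ∀ {PR ℓ ℓ'} → ℓ ≡ ℓ' → Witness φ PR ℓ → Witness φ' PR ℓ' → ∀ {i} → i ∈ bagOf ℓ → φ i ≡ φ' i
    agree e (split α ρ q sα sρ _ eq) (split α' ρ' q' sα' sρ' ctx' _) =
      agree-split {α} {ρ} {q} {α'} {ρ'} {q'} (ctx' sα sρ') (ctx' sα' sρ) eq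
        (cong Label.in₁ e) (cong Label.in₂ e) (cong Label.out e)
    agree _ (single α q sα _ _) (single α' q' _ uniq eq) =
      agree-single (trans (cong (_*M q') (uniq sα)) eq)
    agree () (split _ _ _ _ _ _ _) (single _ _ _ _ _)
    agree () (single _ _ _ _ _) (split _ _ _ _ _ _ _)

  module Parse (φ : Fin k → Fin n) (Items : List (Poly n × Poly n)) where

    -- Only nonempty bags need a witness: the empty product that ends a list of children yields an
    -- empty bag and has no wire.
    Good : Subset k → Set
    Good B = ∃ (_∈ B) → ∃ λ PR → PR ∈ˡ Items × ∃ λ ℓ → Witness φ PR ℓ × bagOf ℓ ≡ B

    Frag : Mono n → Mono n → Set
    Frag α q = Fragment (V φ α) (V φ q) (λ i j → Pos α (φ i) (φ j)) Good

    Context : Poly n → Mono n → Set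
    Context P q = ∀ {α'} → Supp P α' → HomMonomial (α' *M q)

    leaf-frag : ∀ {P R} α q → (∀ {u v} → Pos α u v → Pos α v u) →
      Supp P α → (∀ {α'} → Supp P α' → α' ≡ α) → α *M q ≡ homMono H φ → (P , R) ∈ˡ Items → Frag α q
    leaf-frag α q symm sα uniq eq mem = leaf
      (λ i j p → ∈V⁺ φ {α} p , ∈V⁺ φ {α} (symm p))
      (λ _ → _ , mem , _ , single α q sα uniq eq , refl)

    -- The descent follows the parse tree of α. The product αq stays equal to the monomial of φ
    -- while q collects the factors left aside. The last argument is the wire by which the gate was
    -- reached; a leaf offers it as its witness.
    parse : ∀ {g} (C : Circuit n g) → items C ⊆ˡ Items → ∀ i α q {R} →
      Supp (lookup (evalAll C) i) α → Context (lookup (evalAll C) i) q → α *M q ≡ homMono H φ →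
      (lookup (evalAll C) i , R) ∈ˡ Items → Frag α q

    parse-times : ∀ {g} (C : Circuit n g) → items C ⊆ˡ Items → ∀ is α q →
      timesItems (evalAll C) is ⊆ˡ Items →
      let P = foldr _*P_ oneP (map (lookup (evalAll C)) is) in
      Supp P α → Context P q → α *M q ≡ homMono H φ → Frag α q

    parse (gt ∷ C) sub (suc i) α q sα ctx eq mem =
      parse C (sub ∘ ∈-++⁺ʳ (gateItems gt (evalAll C))) i α q sα ctx eq mem
    parse (var u v _ ∷ C) sub zero α q sα ctx eq mem =
      leaf-frag α q
        (λ {x} {y} p → subst (λ μ → Pos μ y x) (sym α≡) (Pos-varM-sym u v (subst (λ μ → Pos μ x y) α≡ p)))
        sα (λ s → trans (Supp-[-]⁻ s) (sym α≡)) eq mem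
      where α≡ = Supp-[-]⁻ sα
    parse (const c ∷ C) sub zero α q sα ctx eq mem =
      leaf-frag α q
        (λ {x} {y} p → contradiction (subst (λ μ → Pos μ x y) α≡ p) (¬Pos-oneM x y))
        sα (λ s → trans (Supp-[-]⁻ s) (sym α≡)) eq mem
      where α≡ = Supp-[-]⁻ sα
    -- Each term of a summand is a term of the sum, so the context passes to the child with the same
    -- q.
    parse (plus is ∷ C) sub zero α q (c , c∈ , c≢0) ctx eq mem
      with find (∈-concatMap⁻ (lookup (evalAll C)) {xs = is} c∈)
    ... | i , i∈ , c∈ᵢ =
      parse C (sub ∘ ∈-++⁺ʳ (gateItems (plus is) (evalAll C))) i α q (c , c∈ᵢ , c≢0)
        (λ { (c' , c'∈ , c'≢0) → ctx (c' , ∈-concatMap⁺ (lookup (evalAll C)) (lose i∈ c'∈) , c'≢0) })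
        eq (sub (∈-++⁺ˡ (∈-map⁺ _ i∈)))
    parse (times is ∷ C) sub zero α q sα ctx eq mem =
      parse-times C (sub ∘ ∈-++⁺ʳ (gateItems (times is) (evalAll C))) is α q (sub ∘ ∈-++⁺ˡ) sα ctx eq

    parse-times C sub [] α q sub′ sα ctx eq = leaf
      (λ i j p → contradiction (subst (λ μ → Pos μ (φ i) (φ j)) α≡ p) (¬Pos-oneM (φ i) (φ j)))
      (λ { (v , v∈) → contradiction (subst (λ μ → v ∈ V φ μ) α≡ v∈) (V-oneM φ) })
      where α≡ = Supp-[-]⁻ sα
    parse-times C sub (i ∷ is) α q sub′ sα ctx eq
      with Supp-*P⁻ {p = lookup (evalAll C) i} {q = foldr _*P_ oneP (map (lookup (evalAll C)) is)} sα
    ... | β , ρ , sβ , sρ , refl = node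
      (V-*M⁻ φ {β} {ρ}) (V-*M⁺ φ {β} {ρ}) (V-*M⁺ φ {ρ} {q}) (V-*M⁺ φ {β} {q}) (Pos-*M⁻ {α = β} {ρ})
      (λ _ → _ , sub′ (here refl) , _ , split β ρ q sβ sρ (λ s r → ctx (Supp-*P⁺ {p = P} {q = Q} s r)) eq , refl)
      (parse C sub i β (ρ *M q) sβ
        (λ {α'} s → subst HomMonomial (*M-assoc α' ρ q) (ctx (Supp-*P⁺ {p = P} {q = Q} s sρ)))
        (trans (sym (*M-assoc β ρ q)) eq) (sub′ (here refl)))
      (parse-times C sub is ρ (β *M q) (sub′ ∘ there) sρ
        (λ {ρ'} s → subst HomMonomial (move ρ') (ctx (Supp-*P⁺ {p = P} {q = Q} sβ s)))
        (trans (sym (move ρ)) eq))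
      where
      P = lookup (evalAll C) i
      Q = foldr _*P_ oneP (map (lookup (evalAll C)) is)
      move : ∀ ρ' → (β *M ρ') *M q ≡ ρ' *M (β *M q)
      move ρ' = trans (cong (_*M q) (*M-comm β ρ')) (*M-assoc ρ' β q)

-- Counting coloured homomorphisms

homMono-cong : ∀ {k n} (H : Graph k) {φ ψ : Fin k → Fin n} → φ ≗ ψ → homMono H φ ≡ homMono H ψ
homMono-cong H {φ} {ψ} e = trans (homMono-edgeList H φ) (trans
  (cong (foldr _*M_ oneM) (List.map-cong (λ { (i , j) → cong₂ varM (e i) (e j) }) (edgeList H)))
  (sym (homMono-edgeList H ψ)))

allMaps-complete : ∀ k {n} (f : Fin k → Fin n) → ∃ λ g → g ∈ˡ allMaps k n × g ≗ f
allMaps-complete zero    f = _ , here refl , λ ()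
allMaps-complete (suc k) f with allMaps-complete k (f ∘ suc)
... | g , g∈ , e = f zero ∷ᶠ g , ∈-concatMap⁺ _ (lose (∈-allFin (f zero)) (∈-map⁺ _ g∈)) ,
  λ { zero → refl ; (suc i) → e i }

HomPoly-NonNegP : ∀ {k} (H : Graph k) n → NonNegP (HomPoly H n)
HomPoly-NonNegP H n = All.map⁺ (All.tabulate (λ _ → 0≤1ℚ))

Supp-HomPoly⁺ : ∀ {k n} (H : Graph k) {φ : Fin k → Fin n} → (∀ {i j} → φ i ≡ φ j → i ≡ j) →
  Supp (HomPoly H n) (homMono H φ)
Supp-HomPoly⁺ {k} {n} H {φ} inj with allMaps-complete k φ
... | g , g∈ , e = 1ℚ ,
  subst (λ μ → (1ℚ , μ) ∈ˡ HomPoly H n) (homMono-cong H e) (∈-map⁺ _ (∈-filter⁺ (isHom? H) g∈ hom)) , λ ()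
  where
  hom : IsHom H g
  hom i j a gi≡gj with refl ← inj (trans (sym (e i)) (trans gi≡gj (e j))) = subst T (irrefl H i) a

Supp-HomPoly⁻ : ∀ {k n} (H : Graph k) {μ : Mono n} → Supp (HomPoly H n) μ →
  ∃ λ (ψ : Fin k → Fin n) → homMono H ψ ≡ μ
Supp-HomPoly⁻ H (c , c∈ , _) with ∈-map⁻ _ c∈
... | ψ , _ , refl = ψ , refl

foldr-⊔-≤ : ∀ {b} xs → All (_≤ b) xs → foldr _⊔_ 0 xs ≤ b
foldr-⊔-≤ []       []       = z≤n
foldr-⊔-≤ (x ∷ xs) (p ∷ ps) = ℕ.⊔-lub p (foldr-⊔-≤ xs ps)

x∈p⇒0<∣p∣ : ∀ {k} {x : Fin k} {p} → x ∈ p → 0 < ∣ p ∣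
x∈p⇒0<∣p∣ x∈p = ℕ.≤-<-trans z≤n (x∈p⇒∣p-x∣<∣p∣ x∈p)

0<∣p∣⇒nonempty : ∀ {k} (p : Subset k) → 0 < ∣ p ∣ → ∃ (_∈ p)
0<∣p∣⇒nonempty {k} p 0<p with nonempty? p
... | yes ne   = ne
... | no empty = contradiction (subst (0 <_) (trans (cong ∣_∣ (Empty-unique empty)) (∣⊥∣≡0 k)) 0<p) λ ()

-- If all bags had at most t vertices, then t ≤ t ∸ 1. As the subtraction is truncated, this still
-- allows t = 0, where the bag containing vertex `zero` is nonempty.
large-bag : ∀ {k} {H : Graph (suc k)} (D : TreeDecomposition H) {t} → t ≤ width D →
  ∃ λ s → t < ∣ TreeDecomposition.bag D s ∣
large-bag D {t} t≤w with Fin.any? (λ s → t <? ∣ TreeDecomposition.bag D s ∣)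
... | yes found = found
... | no ¬found = contradiction (ℕ.≤-trans (x∈p⇒0<∣p∣ v∈s) (ℕ.≤-trans (small s) (ℕ.≤-reflexive t≡0))) λ ()
  where
  open TreeDecomposition D hiding (width)
  small : ∀ s → ∣ bag s ∣ ≤ t
  small s = ℕ.≮⇒≥ (λ t<s → ¬found (s , t<s))
  t≤t∸1 : t ≤ t ∸ 1
  t≤t∸1 = ℕ.≤-trans t≤w (ℕ.∸-monoˡ-≤ 1 (foldr-⊔-≤ (map (λ s → ∣ bag s ∣) (allFin (suc m)))
    (All.map⁺ (All.tabulate (λ {s} _ → small s)))))
  pred-fixed : ∀ {t} → t ≤ t ∸ 1 → t ≡ 0
  pred-fixed {zero}  _ = refl
  pred-fixed {suc t} h = contradiction h ℕ.1+n≰n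
  t≡0 = pred-fixed t≤t∸1
  s = proj₁ (subtree-nonempty zero)
  v∈s = proj₂ (subtree-nonempty zero)

-- Injective codes and colour classes

bit : Bool → Fin 2
bit false = zero
bit true  = suc zero

bit-injective : ∀ {b c} → bit b ≡ bit c → b ≡ c
bit-injective {false} {false} _ = refl
bit-injective {true}  {true}  _ = refl

subsetCode : ∀ {k} → Subset k → Fin (2 ^ k)
subsetCode []      = zero
subsetCode (b ∷ p) = combine (bit b) (subsetCode p)

subsetCode-injective : ∀ {k} (p q : Subset k) → subsetCode p ≡ subsetCode q → p ≡ q
subsetCode-injective []      []      _ = refl
subsetCode-injective (b ∷ p) (c ∷ q) e =
  let e₁ , e₂ = Fin.combine-injective (bit b) (subsetCode p) (bit c) (subsetCode q) e
  in cong₂ _∷_ (bit-injective e₁) (subsetCode-injective p q e₂)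

kindCode : Kind → Fin 2
kindCode isProduct  = zero
kindCode isVariable = suc zero

kindCode-injective : ∀ {x y} → kindCode x ≡ kindCode y → x ≡ y
kindCode-injective {isProduct}  {isProduct}  _ = refl
kindCode-injective {isVariable} {isVariable} _ = refl

labels : ℕ → ℕ
labels k = 2 * (2 ^ k * (2 ^ k * 2 ^ k))

labelCode : ∀ {k} → Label k → Fin (labels k)
labelCode (label x a b o) =
  combine (kindCode x) (combine (subsetCode a) (combine (subsetCode b) (subsetCode o)))

labelCode-injective : ∀ {k} (ℓ ℓ' : Label k) → labelCode ℓ ≡ labelCode ℓ' → ℓ ≡ ℓ'
labelCode-injective (label x a b o) (label x' a' b' o') e
  with Fin.combine-injective (kindCode x) _ (kindCode x') _ e
... | e₁ , e₂ with Fin.combine-injective (subsetCode a) _ (subsetCode a') _ e₂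
... | e₃ , e₄ with Fin.combine-injective (subsetCode b) _ (subsetCode b') _ e₄
... | e₅ , e₆
  with refl ← kindCode-injective {x} {x'} e₁ | refl ← subsetCode-injective a a' e₃
     | refl ← subsetCode-injective b b' e₅ | refl ← subsetCode-injective o o' e₆ = refl

funToFin-cong : ∀ {m n} {f g : Fin m → Fin n} → f ≗ g → funToFin f ≡ funToFin g
funToFin-cong {zero}  e = refl
funToFin-cong {suc m} e = cong₂ combine (e zero) (funToFin-cong (e ∘ suc))

index-injective : ∀ {A : Set} {x y : A} {xs} (x∈ : x ∈ˡ xs) (y∈ : y ∈ˡ xs) → Any.index x∈ ≡ Any.index y∈ → x ≡ y
index-injective {xs = xs} x∈ y∈ e =
  trans (Any.lookup-index x∈) (trans (cong (List.lookup xs) e) (sym (Any.lookup-index y∈)))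

module Blocks {k n b : ℕ} (fits : suc k * b ≤ n) where

  embed : Fin (suc k) → Fin b → Fin n
  embed i x = inject≤ (combine i x) fits

  col : Fin n → Fin (suc k)
  col u with toℕ u <? suc k * b
  ... | yes u< = proj₁ (remQuot {suc k} b (fromℕ< u<))
  -- A vertex outside the blocks may have any colour, since only the colours of embedded vertices
  -- are prescribed.
  ... | no _   = zero

  col-embed : ∀ i x → col (embed i x) ≡ i
  col-embed i x with toℕ (embed i x) <? suc k * b
  ... | yes u< = trans (cong (proj₁ ∘ remQuot {suc k} b)
          (Fin.toℕ-injective (trans (Fin.toℕ-fromℕ< u<) (Fin.toℕ-inject≤ (combine i x) fits))))
          (cong proj₁ (Fin.remQuot-combine i x))
  ... | no u≮ = contradiction
          (subst (_< suc k * b) (sym (Fin.toℕ-inject≤ (combine i x) fits)) (Fin.toℕ<n (combine i x))) u≮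

  embed-injectiveʳ : ∀ i {x y} → embed i x ≡ embed i y → x ≡ y
  embed-injectiveʳ i {x} {y} e =
    Fin.combine-injectiveʳ i x i y (Fin.inject≤-injective fits fits (combine i x) (combine i y) e)

  copy : (Fin (suc k) → Fin b) → Fin (suc k) → Fin n
  copy f i = embed i (f i)

module Counting {k n b tw : ℕ} (H : Graph (suc k))
  (nbr : ∀ (v : Fin (suc k)) → ∃ λ (u : Fin (suc k)) → Adj H v u)
  (minimal : ∀ (D : TreeDecomposition H) → tw ≤ width D) (fits : suc k * suc b ≤ n)
  {g : ℕ} (C : Circuit n (suc g)) (mono : Monotone C) (comp : Computes C (HomPoly H n)) where

  open Blocks {k} {n} {suc b} fits

  -- A virtual wire into the output is added as a witness for the case that the output is itself a
  -- leaf.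
  Items : List (Poly n × Poly n)
  Items = (output C , oneP) ∷ items C

  root-val : lookup (evalAll C) zero ≡ output C
  root-val with evalAll C
  ... | p ∷ _ = refl

  output-NonNegP : NonNegP (output C)
  output-NonNegP = subst NonNegP root-val (evalAll-NonNegP mono zero)

  coloured : ∀ f → Coloured H nbr col (copy f)
  coloured f i = col-embed i (f i)

  copy-supp : ∀ f → Supp (output C) (homMono H (copy f))
  copy-supp f = coeff≢0⇒Supp (output C) (λ e → Supp⇒coeff≢0 (HomPoly-NonNegP H n)
    (Supp-HomPoly⁺ H {copy f} (λ {i} {j} e → trans (sym (coloured f i)) (trans (cong col e) (coloured f j))))
    (trans (sym (comp _)) e))

  supp-hom : ∀ {μ} → Supp (output C) μ → HomMonomial H nbr col μ
  supp-hom s = Supp-HomPoly⁻ H (coeff≢0⇒Supp (HomPoly H n) (λ e → Supp⇒coeff≢0 output-NonNegP s (trans (comp _) e)))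

  record Coded (f : Fin (suc k) → Fin (suc b)) : Set where
    field
      {item}  : Poly n × Poly n
      item∈   : item ∈ˡ Items
      ℓ       : Label (suc k)
      witness : Witness H nbr col (copy f) item ℓ
      large   : tw < ∣ bagOf ℓ ∣

  coded : ∀ f → Coded f
  coded f = record
    { item∈ = proj₁ (proj₂ found) ; ℓ = proj₁ (proj₂ (proj₂ found))
    ; witness = proj₁ (proj₂ (proj₂ (proj₂ found)))
    ; large = subst (λ B → tw < ∣ B ∣) (sym (proj₂ (proj₂ (proj₂ (proj₂ found))))) (proj₂ big) }
    where
    μ = homMono H (copy f)
    open Parse H nbr col (copy f) Items
    F : Frag μ oneM
    F = parse C there zero μ oneM {oneP}
      (subst (λ P → Supp P μ) (sym root-val) (copy-supp f))
      (λ {α'} s → subst (HomMonomial H nbr col) (sym (*M-identityʳ α')) (supp-hom (subst (λ P → Supp P α') root-val s)))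
      (*M-identityʳ μ)
      (subst (λ P → (P , oneP) ∈ˡ Items) (sym root-val) (here refl))
    D = toTreeDecomposition {H = H} F (λ {i} {j} → Pos-homMono⁺ H (copy f) i j) nbr
    big = large-bag D (minimal D)
    found = Fragment.good F (proj₁ big) (0<∣p∣⇒nonempty _ (ℕ.≤-<-trans z≤n (proj₂ big)))

  free : ℕ
  free = suc k ∸ suc tw

  outside≤ : ∀ {ℓ : Label (suc k)} → tw < ∣ bagOf ℓ ∣ → suc b ^ ∣ ∁ (bagOf ℓ) ∣ ≤ suc b ^ free
  outside≤ {ℓ} large = ℕ.^-monoʳ-≤ (suc b)
    (ℕ.≤-trans (ℕ.≤-reflexive (∣∁p∣≡n∸∣p∣ (bagOf ℓ))) (ℕ.∸-monoʳ-≤ (suc k) large))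

  outsideCode : ∀ ℓ → tw < ∣ bagOf ℓ ∣ → (Fin (suc k) → Fin (suc b)) → Fin (suc b ^ free)
  outsideCode ℓ large f = inject≤ (encode (∁ (bagOf ℓ)) f) (outside≤ {ℓ} large)

  -- Item and label determine f on the bag, by `agree`; the values elsewhere are written out. Larger
  -- bags leave fewer of them, and `inject≤` gives all codes a common range.
  code : ∀ {f} → Coded f → Fin ((length Items * labels (suc k)) * suc b ^ free)
  code {f} c = combine (combine (Any.index item∈) (labelCode ℓ)) (outsideCode ℓ large f)
    where open Coded c

  agree-all : ∀ {f f'} (c : Coded f) (c' : Coded f') → Any.index (Coded.item∈ c) ≡ Any.index (Coded.item∈ c') →
    Coded.ℓ c ≡ Coded.ℓ c' →
    outsideCode (Coded.ℓ c) (Coded.large c) f ≡ outsideCode (Coded.ℓ c') (Coded.large c') f' → f ≗ f'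
  agree-all {f} {f'} c c' e refl e' i with i ∈? bagOf (Coded.ℓ c)
  ... | yes i∈ = embed-injectiveʳ i
    (agree H nbr col (coloured f) (coloured f') refl
      (subst (λ PR → Witness H nbr col (copy f) PR (Coded.ℓ c))
        (index-injective (Coded.item∈ c) (Coded.item∈ c') e) (Coded.witness c))
      (Coded.witness c') i∈)
  ... | no i∉ = begin
    f i                                              ≡⟨ sym (decode-encode zero B f i i∈∁) ⟩
    decode zero B (encode B f) i                     ≡⟨ cong (λ x → decode zero B x i) (Fin.inject≤-injective _ _ _ _ e') ⟩
    decode zero B (encode B f') i                    ≡⟨ decode-encode zero B f' i i∈∁ ⟩
    f' i                                             ∎
    where
    open ≡-Reasoning
    B = ∁ (bagOf (Coded.ℓ c))
    i∈∁ = x∉p⇒x∈∁p i∉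

  code-injective : ∀ {f f'} (c : Coded f) (c' : Coded f') → code c ≡ code c' → f ≗ f'
  code-injective {f} {f'} c c' e =
    agree-all c c' (proj₁ e₃₄) (labelCode-injective (Coded.ℓ c) (Coded.ℓ c') (proj₂ e₃₄)) (proj₂ e₁₂)
    where
    e₁₂ = Fin.combine-injective
      (combine (Any.index (Coded.item∈ c)) (labelCode (Coded.ℓ c))) (outsideCode (Coded.ℓ c) (Coded.large c) f)
      (combine (Any.index (Coded.item∈ c')) (labelCode (Coded.ℓ c'))) (outsideCode (Coded.ℓ c') (Coded.large c') f') e
    e₃₄ = Fin.combine-injective (Any.index (Coded.item∈ c)) (labelCode (Coded.ℓ c))
      (Any.index (Coded.item∈ c')) (labelCode (Coded.ℓ c')) (proj₁ e₁₂)

  count : suc b ^ suc k ≤ (length Items * labels (suc k)) * suc b ^ free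
  count = Fin.injective⇒≤ {f = λ x → code (coded (map-of x))} λ {x} {y} e →
    trans (sym (Fin.funToFin-finToFin {suc k} {suc b} x))
      (trans (funToFin-cong (code-injective (coded (map-of x)) (coded (map-of y)) e))
             (Fin.funToFin-finToFin {suc k} {suc b} y))
    where
    map-of : Fin (suc b ^ suc k) → Fin (suc k) → Fin (suc b)
    map-of = finToFun

  -- Already the constant map yields a bag with more than tw vertices. Thus the truncated
  -- subtraction in `free` is exact.
  tw<k : tw < suc k
  tw<k = ℕ.<-≤-trans large (∣p∣≤n (bagOf ℓ))
    where open Coded (coded (λ _ → zero))

  power-bound : suc b ^ suc tw ≤ labels (suc k) * suc (size C)
  power-bound = ℕ.*-cancelʳ-≤ _ _ (suc b ^ free) {{ℕ.m^n≢0 (suc b) free}} (begin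
    suc b ^ suc tw * suc b ^ free                      ≡⟨ sym (ℕ.^-distribˡ-+-* (suc b) (suc tw) free) ⟩
    suc b ^ (suc tw + free)                            ≡⟨ cong (suc b ^_) (ℕ.m+[n∸m]≡n tw<k) ⟩
    suc b ^ suc k                                      ≤⟨ count ⟩
    (length Items * labels (suc k)) * suc b ^ free     ≡⟨ cong (_* suc b ^ free) (ℕ.*-comm (length Items) (labels (suc k))) ⟩
    (labels (suc k) * length Items) * suc b ^ free     ≡⟨ cong (λ s → (labels (suc k) * suc s) * suc b ^ free) (length-items C) ⟩
    (labels (suc k) * suc (size C)) * suc b ^ free     ∎)
    where open ℕ.≤-Reasoning

-- The lower bound and the theorem

^-distribʳ-* : ∀ t a b → (a * b) ^ t ≡ a ^ t * b ^ t
^-distribʳ-* zero    a b = refl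
^-distribʳ-* (suc t) a b = trans (cong (a * b *_) (^-distribʳ-* t a b)) (ℕ.[m*n]*[o*p]≡[m*o]*[n*p] a b (a ^ t) (b ^ t))

lower-bound : ∀ {k} (H : Graph (suc k)) → (∀ v → ∃ λ u → Adj H v u) →
  ∀ {tw} → (∀ (D : TreeDecomposition H) → tw ≤ width D) →
  Σ ℕ λ c → Σ ℕ λ N → ∀ n → N ≤ n →
    ∀ g (C : Circuit n (suc g)) → Monotone C → Computes C (HomPoly H n) → n ^ suc tw ≤ c * size C
-- Classes have size n / K, and n is at most 2K times that. The threshold makes the class size
-- exceed L, so by `power-bound` the circuit has a wire; then `suc (size C)` is at most twice the
-- size, whence the factor 2.
lower-bound {k} H nbr {tw} minimal = (2 * K) ^ t * (L * 2) , suc L * K , bound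
  where
  K = suc k
  L = labels K
  t = suc tw

  bound : ∀ n → suc L * K ≤ n → ∀ g (C : Circuit n (suc g)) → Monotone C → Computes C (HomPoly H n) →
    n ^ t ≤ ((2 * K) ^ t * (L * 2)) * size C
  bound n N≤n g C mono comp with n / K in n/K≡ | subst (_≤ n / K) (m*n/n≡m (suc L) K) (/-monoˡ-≤ K N≤n)
  ... | suc b | s≤s L≤b = begin
    n ^ t                                  ≤⟨ ℕ.^-monoˡ-≤ t n≤ ⟩
    ((2 * K) * suc b) ^ t                  ≡⟨ ^-distribʳ-* t (2 * K) (suc b) ⟩
    (2 * K) ^ t * suc b ^ t                ≤⟨ ℕ.*-monoʳ-≤ ((2 * K) ^ t) power-bound ⟩
    (2 * K) ^ t * (L * suc (size C))       ≤⟨ ℕ.*-monoʳ-≤ ((2 * K) ^ t) (ℕ.*-monoʳ-≤ L suc-size≤) ⟩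
    (2 * K) ^ t * (L * (2 * size C))       ≡⟨ cong ((2 * K) ^ t *_) (sym (ℕ.*-assoc L 2 (size C))) ⟩
    (2 * K) ^ t * ((L * 2) * size C)       ≡⟨ sym (ℕ.*-assoc ((2 * K) ^ t) (L * 2) (size C)) ⟩
    ((2 * K) ^ t * (L * 2)) * size C       ∎
    where
    open ℕ.≤-Reasoning
    fits : K * suc b ≤ n
    fits = ℕ.≤-trans (ℕ.≤-reflexive (trans (ℕ.*-comm K (suc b)) (cong (_* K) (sym n/K≡)))) (m/n*n≤m n K)
    open Counting {k} {n} {b} {tw} H nbr minimal fits C mono comp
    n≤ : n ≤ (2 * K) * suc b
    n≤ = begin
      n                             ≡⟨ m≡m%n+[m/n]*n n K ⟩
      n % K + n / K * K             ≤⟨ ℕ.+-monoˡ-≤ _ (ℕ.<⇒≤ (m%n<n n K)) ⟩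
      K + n / K * K                 ≡⟨ cong (λ x → K + x * K) n/K≡ ⟩
      K + suc b * K                 ≤⟨ ℕ.+-monoˡ-≤ (suc b * K) (ℕ.m≤m+n K (b * K)) ⟩
      suc b * K + suc b * K         ≡⟨ sym (ℕ.*-distribˡ-+ (suc b) K K) ⟩
      suc b * (K + K)               ≡⟨ ℕ.*-comm (suc b) (K + K) ⟩
      (K + K) * suc b               ≡⟨ cong (λ x → (K + x) * suc b) (sym (ℕ.+-identityʳ K)) ⟩
      (2 * K) * suc b               ∎
    suc-size≤ : suc (size C) ≤ 2 * size C
    suc-size≤ with size C in size≡
    ... | suc s = s≤s (ℕ.≤-trans (ℕ.≤-reflexive (ℕ.+-comm 1 s)) (ℕ.+-monoʳ-≤ s (s≤s z≤n)))
    ... | zero  = contradiction (begin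
        suc b                 ≡⟨ sym (ℕ.*-identityʳ (suc b)) ⟩
        suc b * 1             ≤⟨ ℕ.*-monoʳ-≤ (suc b) (ℕ.m^n>0 (suc b) tw) ⟩
        suc b ^ t             ≤⟨ power-bound ⟩
        L * suc (size C)      ≡⟨ cong (λ s → L * suc s) size≡ ⟩
        L * 1                 ≡⟨ ℕ.*-identityʳ L ⟩
        L                     ≤⟨ L≤b ⟩
        b                     ∎) ℕ.1+n≰n

-- The neighbour is the first step of a walk to some other vertex.
connected⇒neighbour : ∀ {k} (H : Graph (suc (suc k))) → Connected H → ∀ v → ∃ λ u → Adj H v u
connected⇒neighbour H conn zero with conn zero (suc zero)
... | step a _ _ = _ , a
connected⇒neighbour H conn (suc v) with conn (suc v) zero
... | step a _ _ = _ , a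

theorem1 : ∀ {k} (H : Graph k) → 2 ≤ k → Connected H →
    ∀ (tw : ℕ) → IsTreewidth H tw →
    Σ ℕ λ c → Σ ℕ λ N → ∀ n → N ≤ n →
    (Σ ℕ λ g → Σ (Circuit n (suc g)) λ C →
    Monotone C × Computes C (HomPoly H n) × size C ≤ c * n ^ (tw + 1))
    × (∀ g (C : Circuit n (suc g)) → Monotone C → Computes C (HomPoly H n) →
    n ^ (tw + 1) ≤ c * size C)
theorem1 {suc (suc k)} H (s≤s (s≤s z≤n)) conn tw ((D , refl) , minimal)
  rewrite ℕ.+-comm (width D) 1
  with upper-bound H D | lower-bound H (connected⇒neighbour H conn) minimal
-- One constant has to serve both bounds, and `suc N` makes n positive, as the upper bound requires.
... | c₁ , upper | c₂ , N , lower = c₁ + c₂ , suc N , λ n N<n →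
  (let g , C , mono , comp , size≤ = upper n (ℕ.≤-trans (s≤s z≤n) N<n)
   in g , C , mono , comp , ℕ.≤-trans size≤ (ℕ.*-monoˡ-≤ _ (ℕ.m≤m+n c₁ c₂))) ,
  λ g C mono comp → ℕ.≤-trans (lower n (ℕ.<⇒≤ N<n) g C mono comp) (ℕ.*-monoˡ-≤ (size C) (ℕ.m≤n+m c₂ c₁))
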